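{- Let $\varphi$ be a closed $\mu\mathrm{HML}$ formula. There is a monitor $m\in\mathrm{Mon}$ that is sound for $[\![\varphi]\!]$ and violation-persistently informative (i.e. for every $s\in\mathrm{Act}^*$ there is $f\in\mathrm{Act}^\infty$ with $\mathrm{rej}(m,sf)$) if and only if there is $\psi\in\mathrm{SPIHML}$ with $[\![\psi]\!]=[\![\varphi]\!]$. Likewise, there is a monitor $m\in\mathrm{Mon}$ that is sound for $[\![\varphi]\!]$ and satisfaction-persistently informative (for every $s\in\mathrm{Act}^*$ there is $f$ with $\mathrm{acc}(m,sf)$) if and only if there is $\psi\in\mathrm{CPIHML}$ with $[\![\psi]\!]=[\![\varphi]\!]$.
   Context: $\mathrm{Act}$ is a finite set of actions, $\mathrm{Act}^\infty=\mathrm{Act}^*\cup\mathrm{Act}^\omega$. Logic $\mu\mathrm{HML}$: $\varphi::=\mathsf{tt}\mid\mathsf{ff}\mid\varphi\lor\varphi\mid\varphi\land\varphi\mid\langle a\rangle\varphi\mid[a]\varphi\mid\min X.\varphi\mid\max X.\varphi\mid X$, interpreted over $\mathrm{Act}^\infty$: $[\![\mathsf{tt}]\!]=\mathrm{Act}^\infty$, $[\![\mathsf{ff}]\!]=\emptyset$, $\lor,\land$ union/intersection, $[\![[a]\varphi]\!]=\{f\mid f=af'\Rightarrow f'\in[\![\varphi]\!]\}$, $[\![\langle a\rangle\varphi]\!]=\{af\mid f\in[\![\varphi]\!]\}$, $\min X$/$\max X$ least/greatest fixpoints (with valuations for variables). Formulae are closed and guarded. $\mathrm{sHML}$: $\varphi::=\mathsf{tt}\mid\mathsf{ff}\mid[a]\varphi\mid\varphi\land\varphi\mid\max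 X.\varphi\mid X$; $\mathrm{cHML}$: $\varphi::=\mathsf{tt}\mid\mathsf{ff}\mid\langle a\rangle\varphi\mid\varphi\lor\varphi\mid\min X.\varphi\mid X$. The explicit fragment $\mathrm{eHML}$: $\varphi::=\mathsf{tt}\mid\mathsf{ff}\mid\min X.\varphi\mid\max X.\varphi\mid X\mid\varphi\lor\varphi\mid\varphi\land\varphi\mid\bigvee_{a\in\mathrm{Act}}\langle a\rangle\varphi_a\mid\bigwedge_{a\in\mathrm{Act}}[a]\varphi_a$. For a closed $\mathrm{sHML}$ (resp. $\mathrm{cHML}$) formula $\varphi$, a subformula $\psi$ of $\varphi$ can refute (resp. verify) in $0$ unfoldings if $\mathsf{ff}$ (resp. $\mathsf{tt}$) occurs in $\psi$; it can refute (resp. verify) in $k+1$ unfoldings if it can in $k$ unfoldings, or $X$ occurs in $\psi$ and $\psi$ is in the scope of a subformula $\max X.\psi'$ (resp. $\min X.\psi'$) that can refute (resp. verify) in $k$ unfoldings; it can refute (verify) if it can in $k$ unfoldings for some $k\ge0$. $\mathrm{SPIHML}=\{\varphi_1\land\varphi_2\in\mu\mathrm{HML}\mid\varphi_1\in\mathrm{sHML}\cap\mathrm{eHML}\text{ and every subformula of }\varphi_1\text{ can refute}\}$; $\mathrm{CPIHML}=\{\varphi_1\lor\varphi_2\in\mu\mathrm{HML}\mid\varphi_1\in\mathrm{cHML}\cap\mathrm{eHML}\text{ and every subformula of }\varphi_1\text{ can verify}\}$. Monitors $\mathrm{Mon}$: closed terms $m::=v\mid a.m\mid m+m\mid m\otimes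 m\mid m\oplus m\mid\mathrm{rec}\,x.m\mid x$, $v\in\{\mathsf{end},\mathsf{no},\mathsf{yes}\}$, with transitions: $a.m\xrightarrow{a}m$; $v\xrightarrow{a}v$; $\mathrm{rec}\,x.m\xrightarrow{a}n$ if $m[\mathrm{rec}\,x.m/x]\xrightarrow{a}n$; $m+n\xrightarrow{a}m'$ if $m\xrightarrow{a}m'$ (and symmetrically); for $\odot\in\{\otimes,\oplus\}$: $m\odot n\xrightarrow{a}m'\odot n'$ if both components make the $a$-step; $m\odot n\xrightarrow{\tau}m'\odot n$ if $m\xrightarrow{\tau}m'$ (and symmetrically); $\mathsf{end}\odot\mathsf{end}\xrightarrow{\tau}\mathsf{end}$; $\mathsf{yes}\otimes m\xrightarrow{\tau}m$, $\mathsf{no}\otimes m\xrightarrow{\tau}\mathsf{no}$, $\mathsf{no}\oplus m\xrightarrow{\tau}m$, $\mathsf{yes}\oplus m\xrightarrow{\tau}\mathsf{yes}$ (also symmetrically). $\mathrm{acc}(m,s)$/$\mathrm{rej}(m,s)$ for finite $s$: $m$ reaches $\mathsf{yes}$/$\mathsf{no}$ via transitions with visible labels $s$ interleaved with $\tau$-steps; for infinite $t$: for some finite prefix of $t$. $m$ is sound for $P$ if $\mathrm{acc}(m,f)\Rightarrow f\in P$ and $\mathrm{rej}(m,f)\Rightarrow f\notin P$. -}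

module Defs where

open import Level using (Lift; lift) renaming (suc to lsuc; zero to lzero)
open import Data.Nat using (ℕ; zero; suc)
open import Data.Fin using (Fin; zero; suc)
open import Data.List using (List; []; _∷_; take)
open import Data.Maybe using (Maybe; just; nothing)
open import Data.Product using (Σ; _×_; _,_; ∃)
open import Data.Sum using (_⊎_; inj₁; inj₂)
open import Data.Unit using (⊤)
open import Data.Empty using (⊥)
open import Relation.Nullary using (¬_)
open import Relation.Binary.PropositionalEquality using (_≡_)

-- Actions: Act = Fin k (an arbitrary finite set, up to renaming).

Act : ℕ → Set
Act k = Fin k

data Trace (k : ℕ) : Set where
  fin : List (Act k) → Trace k
  inf : (ℕ → Act k) → Trace k

cons : ∀ {k} → Act k → Trace k → Trace k
cons a (fin l) = fin (a ∷ l)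
cons a (inf g) = inf (λ { zero → a ; (suc i) → g i })

_·_ : ∀ {k} → List (Act k) → Trace k → Trace k
[] · t = t
(a ∷ s) · t = cons a (s · t)

prefix : ∀ {k} → ℕ → (ℕ → Act k) → List (Act k)
prefix zero g = []
prefix (suc n) g = g zero ∷ prefix n (λ i → g (suc i))

data Fml (k : ℕ) (d : ℕ) : Set where
  tt ff : Fml k d
  _∨_ _∧_ : Fml k d → Fml k d → Fml k d
  ⟨_⟩_ [_]_ : Act k → Fml k d → Fml k d
  minF maxF : Fml k (suc d) → Fml k d
  var : Fin d → Fml k d

infixr 6 _∧_
infixr 5 _∨_
infix 7 ⟨_⟩_ [_]_

data Unguarded {k : ℕ} : ∀ {d} → Fml k d → Fin d → Set where
  uvar  : ∀ {d} {i : Fin d} → Unguarded (var i) i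
  u∨l   : ∀ {d} {φ ψ : Fml k d} {i} → Unguarded φ i → Unguarded (φ ∨ ψ) i
  u∨r   : ∀ {d} {φ ψ : Fml k d} {i} → Unguarded ψ i → Unguarded (φ ∨ ψ) i
  u∧l   : ∀ {d} {φ ψ : Fml k d} {i} → Unguarded φ i → Unguarded (φ ∧ ψ) i
  u∧r   : ∀ {d} {φ ψ : Fml k d} {i} → Unguarded ψ i → Unguarded (φ ∧ ψ) i
  umin  : ∀ {d} {φ : Fml k (suc d)} {i} → Unguarded φ (suc i) → Unguarded (minF φ) i
  umax  : ∀ {d} {φ : Fml k (suc d)} {i} → Unguarded φ (suc i) → Unguarded (maxF φ) i

data Guarded {k : ℕ} : ∀ {d} → Fml k d → Set where
  gtt  : ∀ {d} → Guarded {d = d} tt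
  gff  : ∀ {d} → Guarded {d = d} ff
  gvar : ∀ {d} {i : Fin d} → Guarded (var i)
  g∨   : ∀ {d} {φ ψ : Fml k d} → Guarded φ → Guarded ψ → Guarded (φ ∨ ψ)
  g∧   : ∀ {d} {φ ψ : Fml k d} → Guarded φ → Guarded ψ → Guarded (φ ∧ ψ)
  g⟨⟩  : ∀ {d} {a} {φ : Fml k d} → Guarded φ → Guarded (⟨ a ⟩ φ)
  g[]  : ∀ {d} {a} {φ : Fml k d} → Guarded φ → Guarded ([ a ] φ)
  gmin : ∀ {d} {φ : Fml k (suc d)} → Guarded φ → ¬ Unguarded φ zero → Guarded (minF φ)
  gmax : ∀ {d} {φ : Fml k (suc d)} → Guarded φ → ¬ Unguarded φ zero → Guarded (maxF φ)

-- Semantics over Act^∞.  Sets of traces are predicates; valuations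
-- assign (Set-valued) predicates to variables; fixpoints are the
-- Knaster–Tarski least/greatest fixpoints (intersection of prefixed
-- points / union of postfixed points).

Pred₀ : ℕ → Set₁
Pred₀ k = Trace k → Set

Env : ℕ → ℕ → Set₁
Env k d = Fin d → Pred₀ k

extend : ∀ {k d} → Pred₀ k → Env k d → Env k (suc d)
extend P ρ zero = P
extend P ρ (suc i) = ρ i

Dia : ∀ {k ℓ} → Act k → (Trace k → Set ℓ) → Trace k → Set ℓ
Dia a P (fin []) = Lift _ ⊥
Dia a P (fin (b ∷ l)) = (b ≡ a) × P (fin l)
Dia a P (inf g) = (g zero ≡ a) × P (inf (λ i → g (suc i)))

Box : ∀ {k ℓ} → Act k → (Trace k → Set ℓ) → Trace k → Set ℓ
Box a P (fin []) = Lift _ ⊤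
Box a P (fin (b ∷ l)) = b ≡ a → P (fin l)
Box a P (inf g) = g zero ≡ a → P (inf (λ i → g (suc i)))

⟦_⟧ : ∀ {k d} → Fml k d → Env k d → Trace k → Set₁
⟦ tt ⟧ ρ t = Lift _ ⊤
⟦ ff ⟧ ρ t = Lift _ ⊥
⟦ φ ∨ ψ ⟧ ρ t = ⟦ φ ⟧ ρ t ⊎ ⟦ ψ ⟧ ρ t
⟦ φ ∧ ψ ⟧ ρ t = ⟦ φ ⟧ ρ t × ⟦ ψ ⟧ ρ t
⟦ ⟨ a ⟩ φ ⟧ ρ t = Dia a (⟦ φ ⟧ ρ) t
⟦ [ a ] φ ⟧ ρ t = Box a (⟦ φ ⟧ ρ) t
⟦ var i ⟧ ρ t = Lift _ (ρ i t)
⟦ minF φ ⟧ ρ t =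
  (P : Pred₀ _) → (∀ t' → ⟦ φ ⟧ (extend P ρ) t' → P t') → P t
⟦ maxF φ ⟧ ρ t =
  Σ (Pred₀ _) λ P → (∀ t' → P t' → ⟦ φ ⟧ (extend P ρ) t') × P t

emptyEnv : ∀ {k} → Env k 0
emptyEnv ()

⟦_⟧₀ : ∀ {k} → Fml k 0 → Trace k → Set₁
⟦ φ ⟧₀ = ⟦ φ ⟧ emptyEnv

_≐_ : ∀ {k} → (Trace k → Set₁) → (Trace k → Set₁) → Set₁
P ≐ Q = ∀ t → (P t → Q t) × (Q t → P t)

data IsSHML {k : ℕ} : ∀ {d} → Fml k d → Set where
  stt  : ∀ {d} → IsSHML {d = d} tt
  sff  : ∀ {d} → IsSHML {d = d} ff
  s[]  : ∀ {d} {a} {φ : Fml k d} → IsSHML φ → IsSHML ([ a ] φ)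
  s∧   : ∀ {d} {φ ψ : Fml k d} → IsSHML φ → IsSHML ψ → IsSHML (φ ∧ ψ)
  smax : ∀ {d} {φ : Fml k (suc d)} → IsSHML φ → IsSHML (maxF φ)
  svar : ∀ {d} {i : Fin d} → IsSHML (var i)

data IsCHML {k : ℕ} : ∀ {d} → Fml k d → Set where
  ctt  : ∀ {d} → IsCHML {d = d} tt
  cff  : ∀ {d} → IsCHML {d = d} ff
  c⟨⟩  : ∀ {d} {a} {φ : Fml k d} → IsCHML φ → IsCHML (⟨ a ⟩ φ)
  c∨   : ∀ {d} {φ ψ : Fml k d} → IsCHML φ → IsCHML ψ → IsCHML (φ ∨ ψ)
  cmin : ∀ {d} {φ : Fml k (suc d)} → IsCHML φ → IsCHML (minF φ)
  cvar : ∀ {d} {i : Fin d} → IsCHML (var i)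

-- Explicit fragment eHML: its own grammar, with ⋁_{a∈Act}⟨a⟩φ_a and
-- ⋀_{a∈Act}[a]φ_a abbreviating right-nested binary disjunctions /
-- conjunctions over Act = Fin k in enumeration order (empty ⋁ = ff,
-- empty ⋀ = tt).

bigOr : ∀ {k d m} → (Fin m → Fml k d) → Fml k d
bigOr {m = zero} f = ff
bigOr {m = suc zero} f = f zero
bigOr {m = suc (suc m)} f = f zero ∨ bigOr (λ i → f (suc i))

bigAnd : ∀ {k d m} → (Fin m → Fml k d) → Fml k d
bigAnd {m = zero} f = tt
bigAnd {m = suc zero} f = f zero
bigAnd {m = suc (suc m)} f = f zero ∧ bigAnd (λ i → f (suc i))

data EHML (k : ℕ) (d : ℕ) : Set where
  ett eff : EHML k d
  emin emax : EHML k (suc d) → EHML k d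
  evar : Fin d → EHML k d
  _e∨_ _e∧_ : EHML k d → EHML k d → EHML k d
  eDia : (Act k → EHML k d) → EHML k d
  eBox : (Act k → EHML k d) → EHML k d

⌊_⌋ : ∀ {k d} → EHML k d → Fml k d
⌊ ett ⌋ = tt
⌊ eff ⌋ = ff
⌊ emin e ⌋ = minF ⌊ e ⌋
⌊ emax e ⌋ = maxF ⌊ e ⌋
⌊ evar i ⌋ = var i
⌊ e e∨ e' ⌋ = ⌊ e ⌋ ∨ ⌊ e' ⌋
⌊ e e∧ e' ⌋ = ⌊ e ⌋ ∧ ⌊ e' ⌋
⌊ eDia f ⌋ = bigOr (λ a → ⟨ a ⟩ ⌊ f a ⌋)
⌊ eBox f ⌋ = bigAnd (λ a → [ a ] ⌊ f a ⌋)

IsEHML : ∀ {k d} → Fml k d → Set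
IsEHML {k} {d} φ = Σ (EHML k d) λ e → ⌊ e ⌋ ≡ φ

data Pos {k : ℕ} : ∀ {d} → Fml k d → Set where
  here : ∀ {d} {φ : Fml k d} → Pos φ
  p∨l  : ∀ {d} {φ ψ : Fml k d} → Pos φ → Pos (φ ∨ ψ)
  p∨r  : ∀ {d} {φ ψ : Fml k d} → Pos ψ → Pos (φ ∨ ψ)
  p∧l  : ∀ {d} {φ ψ : Fml k d} → Pos φ → Pos (φ ∧ ψ)
  p∧r  : ∀ {d} {φ ψ : Fml k d} → Pos ψ → Pos (φ ∧ ψ)
  p⟨⟩  : ∀ {d} {a} {φ : Fml k d} → Pos φ → Pos (⟨ a ⟩ φ)
  p[]  : ∀ {d} {a} {φ : Fml k d} → Pos φ → Pos ([ a ] φ)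
  pmin : ∀ {d} {φ : Fml k (suc d)} → Pos φ → Pos (minF φ)
  pmax : ∀ {d} {φ : Fml k (suc d)} → Pos φ → Pos (maxF φ)

depth : ∀ {k d} {φ : Fml k d} → Pos φ → ℕ
depth {d = d} here = d
depth (p∨l p) = depth p
depth (p∨r p) = depth p
depth (p∧l p) = depth p
depth (p∧r p) = depth p
depth (p⟨⟩ p) = depth p
depth (p[] p) = depth p
depth (pmin p) = depth p
depth (pmax p) = depth p

sub : ∀ {k d} {φ : Fml k d} → (p : Pos φ) → Fml k (depth p)
sub {φ = φ} here = φ
sub (p∨l p) = sub p
sub (p∨r p) = sub p
sub (p∧l p) = sub p
sub (p∧r p) = sub p
sub (p⟨⟩ p) = sub p
sub (p[] p) = sub p
sub (pmin p) = sub p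
sub (pmax p) = sub p

data _≼_ {k : ℕ} : ∀ {d} {φ : Fml k d} → Pos φ → Pos φ → Set where
  ≼here : ∀ {d} {φ : Fml k d} {p : Pos φ} → here ≼ p
  ≼∨l  : ∀ {d} {φ ψ : Fml k d} {q p : Pos φ} → q ≼ p → p∨l {ψ = ψ} q ≼ p∨l p
  ≼∨r  : ∀ {d} {φ ψ : Fml k d} {q p : Pos ψ} → q ≼ p → p∨r {φ = φ} q ≼ p∨r p
  ≼∧l  : ∀ {d} {φ ψ : Fml k d} {q p : Pos φ} → q ≼ p → p∧l {ψ = ψ} q ≼ p∧l p
  ≼∧r  : ∀ {d} {φ ψ : Fml k d} {q p : Pos ψ} → q ≼ p → p∧r {φ = φ} q ≼ p∧r p
  ≼⟨⟩  : ∀ {d} {a} {φ : Fml k d} {q p : Pos φ} → q ≼ p → p⟨⟩ {a = a} q ≼ p⟨⟩ p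
  ≼[]  : ∀ {d} {a} {φ : Fml k d} {q p : Pos φ} → q ≼ p → p[] {a = a} q ≼ p[] p
  ≼min : ∀ {d} {φ : Fml k (suc d)} {q p : Pos φ} → q ≼ p → pmin q ≼ pmin p
  ≼max : ∀ {d} {φ : Fml k (suc d)} {q p : Pos φ} → q ≼ p → pmax q ≼ pmax p

_≺_ : ∀ {k d} {φ : Fml k d} → Pos φ → Pos φ → Set
q ≺ p = (q ≼ p) × ¬ (q ≡ p)

resolve : ∀ {k d} {φ : Fml k d} → (p : Pos φ) → Fin (depth p) → Fin d ⊎ Pos φ
resolve here i = inj₁ i
resolve (p∨l p) i with resolve p i
... | inj₁ x = inj₁ x
... | inj₂ q = inj₂ (p∨l q)
resolve (p∨r p) i with resolve p i
... | inj₁ x = inj₁ x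
... | inj₂ q = inj₂ (p∨r q)
resolve (p∧l p) i with resolve p i
... | inj₁ x = inj₁ x
... | inj₂ q = inj₂ (p∧l q)
resolve (p∧r p) i with resolve p i
... | inj₁ x = inj₁ x
... | inj₂ q = inj₂ (p∧r q)
resolve (p⟨⟩ p) i with resolve p i
... | inj₁ x = inj₁ x
... | inj₂ q = inj₂ (p⟨⟩ q)
resolve (p[] p) i with resolve p i
... | inj₁ x = inj₁ x
... | inj₂ q = inj₂ (p[] q)
resolve (pmin p) i with resolve p i
... | inj₁ zero = inj₂ here
... | inj₁ (suc x) = inj₁ x
... | inj₂ q = inj₂ (pmin q)
resolve (pmax p) i with resolve p i
... | inj₁ zero = inj₂ here
... | inj₁ (suc x) = inj₁ x
... | inj₂ q = inj₂ (pmax q)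

FfIn : ∀ {k d} {φ : Fml k d} → Pos φ → Set
FfIn {φ = φ} p = Σ (Pos φ) λ r → (p ≼ r) × (sub r ≡ ff)

TtIn : ∀ {k d} {φ : Fml k d} → Pos φ → Set
TtIn {φ = φ} p = Σ (Pos φ) λ r → (p ≼ r) × (sub r ≡ tt)

BoundOccIn : ∀ {k d} {φ : Fml k d} → Pos φ → Pos φ → Set
BoundOccIn {φ = φ} p q =
  Σ (Pos φ) λ r → Σ (Fin (depth r)) λ i →
    (p ≼ r) × (sub r ≡ var i) × (resolve r i ≡ inj₂ q)

IsMaxF IsMinF : ∀ {k d} → Fml k d → Set
IsMaxF {k} {d} φ = Σ (Fml k (suc d)) λ ψ → φ ≡ maxF ψ
IsMinF {k} {d} φ = Σ (Fml k (suc d)) λ ψ → φ ≡ minF ψ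

data CanRefuteIn {k : ℕ} (φ : Fml k 0) : ℕ → Pos φ → Set where
  r0   : ∀ {p} → FfIn p → CanRefuteIn φ zero p
  rmon : ∀ {n p} → CanRefuteIn φ n p → CanRefuteIn φ (suc n) p
  rvar : ∀ {n p} (q : Pos φ) → IsMaxF (sub q) → q ≺ p → BoundOccIn p q →
         CanRefuteIn φ n q → CanRefuteIn φ (suc n) p

data CanVerifyIn {k : ℕ} (φ : Fml k 0) : ℕ → Pos φ → Set where
  v0   : ∀ {p} → TtIn p → CanVerifyIn φ zero p
  vmon : ∀ {n p} → CanVerifyIn φ n p → CanVerifyIn φ (suc n) p
  vvar : ∀ {n p} (q : Pos φ) → IsMinF (sub q) → q ≺ p → BoundOccIn p q →
         CanVerifyIn φ n q → CanVerifyIn φ (suc n) p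

CanRefute CanVerify : ∀ {k} (φ : Fml k 0) → Pos φ → Set
CanRefute φ p = Σ ℕ λ n → CanRefuteIn φ n p
CanVerify φ p = Σ ℕ λ n → CanVerifyIn φ n p

SPIHML : ∀ {k} → Fml k 0 → Set
SPIHML {k} ψ = Σ (Fml k 0) λ φ₁ → Σ (Fml k 0) λ φ₂ →
  (ψ ≡ φ₁ ∧ φ₂) × IsSHML φ₁ × IsEHML φ₁ × (∀ (p : Pos φ₁) → CanRefute φ₁ p)

CPIHML : ∀ {k} → Fml k 0 → Set
CPIHML {k} ψ = Σ (Fml k 0) λ φ₁ → Σ (Fml k 0) λ φ₂ →
  (ψ ≡ φ₁ ∨ φ₂) × IsCHML φ₁ × IsEHML φ₁ × (∀ (p : Pos φ₁) → CanVerify φ₁ p)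

data Verdict : Set where
  end no yes : Verdict

data Op : Set where
  ⊗ ⊕ : Op

data Mon (k : ℕ) (d : ℕ) : Set where
  verd : Verdict → Mon k d
  act  : Act k → Mon k d → Mon k d
  _+_  : Mon k d → Mon k d → Mon k d
  par  : Op → Mon k d → Mon k d → Mon k d
  rec  : Mon k (suc d) → Mon k d
  mvar : Fin d → Mon k d

rename : ∀ {k d e} → (Fin d → Fin e) → Mon k d → Mon k e
rename r (verd v) = verd v
rename r (act a m) = act a (rename r m)
rename r (m + n) = rename r m + rename r n
rename r (par o m n) = par o (rename r m) (rename r n)
rename r (rec m) = rec (rename (λ { zero → zero ; (suc i) → suc (r i) }) m)
rename r (mvar i) = mvar (r i)

subst : ∀ {k d e} → (Fin d → Mon k e) → Mon k d → Mon k e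
subst σ (verd v) = verd v
subst σ (act a m) = act a (subst σ m)
subst σ (m + n) = subst σ m + subst σ n
subst σ (par o m n) = par o (subst σ m) (subst σ n)
subst σ (rec m) = rec (subst (λ { zero → mvar zero ; (suc i) → rename suc (σ i) }) m)
subst σ (mvar i) = σ i

_[_] : ∀ {k} → Mon k 1 → Mon k 0 → Mon k 0
m [ n ] = subst (λ { zero → n ; (suc ()) }) m

data Label (k : ℕ) : Set where
  τ   : Label k
  vis : Act k → Label k

data _─[_]→_ {k : ℕ} : Mon k 0 → Label k → Mon k 0 → Set where
  mAct  : ∀ {a m} → act a m ─[ vis a ]→ m
  mVerd : ∀ {v a} → verd v ─[ vis a ]→ verd v
  mRec  : ∀ {m a n} → (m [ rec m ]) ─[ vis a ]→ n → rec m ─[ vis a ]→ n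
  mSelL : ∀ {m n a m'} → m ─[ vis a ]→ m' → (m + n) ─[ vis a ]→ m'
  mSelR : ∀ {m n a n'} → n ─[ vis a ]→ n' → (m + n) ─[ vis a ]→ n'
  mPar  : ∀ {o m n a m' n'} → m ─[ vis a ]→ m' → n ─[ vis a ]→ n' →
          par o m n ─[ vis a ]→ par o m' n'
  mTauL : ∀ {o m n m'} → m ─[ τ ]→ m' → par o m n ─[ τ ]→ par o m' n
  mTauR : ∀ {o m n n'} → n ─[ τ ]→ n' → par o m n ─[ τ ]→ par o m n'
  mVrE  : ∀ {o} → par o (verd end) (verd end) ─[ τ ]→ verd end
  mYesCL : ∀ {m} → par ⊗ (verd yes) m ─[ τ ]→ m
  mYesCR : ∀ {m} → par ⊗ m (verd yes) ─[ τ ]→ m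
  mNoCL  : ∀ {m} → par ⊗ (verd no) m ─[ τ ]→ verd no
  mNoCR  : ∀ {m} → par ⊗ m (verd no) ─[ τ ]→ verd no
  mNoDL  : ∀ {m} → par ⊕ (verd no) m ─[ τ ]→ m
  mNoDR  : ∀ {m} → par ⊕ m (verd no) ─[ τ ]→ m
  mYesDL : ∀ {m} → par ⊕ (verd yes) m ─[ τ ]→ verd yes
  mYesDR : ∀ {m} → par ⊕ m (verd yes) ─[ τ ]→ verd yes

data _⇒[_]_ {k : ℕ} : Mon k 0 → List (Act k) → Mon k 0 → Set where
  wRefl : ∀ {m} → m ⇒[ [] ] m
  wTau  : ∀ {m m' s n} → m ─[ τ ]→ m' → m' ⇒[ s ] n → m ⇒[ s ] n
  wAct  : ∀ {m m' a s n} → m ─[ vis a ]→ m' → m' ⇒[ s ] n → m ⇒[ a ∷ s ] n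

acc rej : ∀ {k} → Mon k 0 → Trace k → Set
acc m (fin s) = m ⇒[ s ] verd yes
acc m (inf g) = Σ ℕ λ n → m ⇒[ prefix n g ] verd yes
rej m (fin s) = m ⇒[ s ] verd no
rej m (inf g) = Σ ℕ λ n → m ⇒[ prefix n g ] verd no

Sound : ∀ {k} → Mon k 0 → (Trace k → Set₁) → Set₁
Sound m P = ∀ t → (acc m t → P t) × (rej m t → ¬ P t)

ViolationPI SatisfactionPI : ∀ {k} → Mon k 0 → Set
ViolationPI {k} m = ∀ (s : List (Act k)) → Σ (Trace k) λ f → rej m (s · f)
SatisfactionPI {k} m = ∀ (s : List (Act k)) → Σ (Trace k) λ f → acc m (s · f)

{-# OPTIONS --safe #-}

-- Both sides are equivalent to the existence of a word w such that a trace
-- violates (satisfies) φ as soon as w occurs in it, no matter after which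
-- prefix.  Given w, the monitor guesses where w starts, and "w does not occur"
-- is a one-variable sHML formula all of whose subformulas can refute.
-- Conversely, w is a synchronizing word: only finitely many states have to be
-- driven to the verdict, and w is built by taking care of one after the other.
-- For a formula the states are its subformulas.  For a monitor they are the
-- classes of prefixes with the same continuations leading to the verdict; that
-- there are finitely many is shown by an automaton which reads words backwards
-- and stores, for every two subterms, whether the first reaches a verdict
-- before the second gets stuck.

module Submission where

open import Defs
open import Data.Nat using (ℕ)
open import Data.Product using (Σ; _×_)
open import Function.Bundles using (_⇔_)

open import Data.Bool using (Bool; true; false; if_then_else_)
open import Data.Empty using (⊥; ⊥-elim)
open import Data.Fin as Fin using (Fin; zero; suc; toℕ; funToFin; finToFun)
import Data.Fin.Properties as Finₚ
open import Data.List using (List; []; _∷_; _++_; cartesianProduct; cartesianProductWith;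
  length; foldr; take; drop; allFin; lookup)
import Data.List.Properties as Listₚ
import Data.List.Membership.DecPropositional as Dec∈
open import Data.List.Membership.Propositional using (_∈_; lose; find)
import Data.List.Membership.Propositional.Properties as ∈ₚ
open import Data.List.Relation.Binary.Prefix.Heterogeneous using (Prefix; []; _∷_)
import Data.List.Relation.Binary.Prefix.Heterogeneous.Properties as Prefixₚ
open import Data.List.Relation.Unary.Any as Any using (here; there)
import Data.List.Relation.Unary.Any.Properties as Anyₚ
open import Data.Maybe as Maybe using (Maybe; just; nothing; zipWith)
open import Data.Nat as ℕ using (zero; suc; _≤_; _<_; z≤n; s≤s; _^_)
open import Data.Nat.Induction using (<-wellFounded)
import Data.Nat.Properties as ℕₚ
open import Data.Product as Product using (∃₂; ∃-syntax; Σ-syntax; _,_; proj₁; proj₂)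
import Data.Product.Properties as Productₚ
open import Data.Sum as Sum using (_⊎_; inj₁; inj₂)
open import Data.Unit using (⊤)
open import Function using (_∘_; id; case_of_)
open import Function.Bundles using (mk⇔; module Equivalence)
open import Function.Construct.Identity using (⇔-id)
open import Induction.WellFounded using (Acc) renaming (acc to accessible)
open import Level using (Level; Lift; lift)
open import Relation.Binary.Definitions using (DecidableEquality)
open import Relation.Binary.PropositionalEquality as ≡
  using (_≡_; refl; sym; trans; cong; cong₂; ≡-≟-identity; module ≡-Reasoning)
open import Relation.Nullary using (Dec; ¬_; does) renaming (yes to isYes; no to isNo)
open import Relation.Nullary.Decidable using (map′; _×-dec_; _⊎-dec_; dec⇒maybe)

open Equivalence using (to; from)

-- The obstacle for monitors is parallel composition below a recursion: `rec x. a.(x ⊗ x)` doubles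
-- with every action, so infinitely many monitors are reachable. Nor can the components be followed
-- independently, for one that gets stuck blocks the composition unless the other has reached the
-- absorbing verdict by then. What stays finite is the set of races between two subterms. Pairs
-- suffice although compositions nest: the prefixes of a word are linearly ordered, so a run that
-- wins against each of several opponents wins against all of them with its shortest version. The
-- races on `a ∷ w` are determined by those on `w`, hence the backward reading; a prefix then acts
-- as a set of states, which is the origin of the bound `2 ^ N`. The obstacle for formulas is
-- predicativity: meanings live in `Set₁`, environments hold `Set`-valued predicates, so a fixpoint
-- cannot be the value of its own variable. A variable ranges over all prefixed points of its body
-- instead.

-- Synchronizing words of automata that read backwards

collect : ∀ {ℓ : Level} {A : Set} {n} (G : Fin n → List A → Set ℓ) →
          (∀ i {w} u → G i w → G i (w ++ u)) → (∀ i w → Σ[ u ∈ List A ] G i (w ++ u)) →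
          ∀ w → Σ[ u ∈ List A ] (∀ i → G i (w ++ u))
collect {n = zero} G mono ext w = [] , λ ()
collect {n = suc n} G mono ext w =
  let u , g = collect (λ i → G (suc i)) (λ i → mono (suc i)) (λ i → ext (suc i)) w
      u' , g' = ext zero (w ++ u)
      assoc = Listₚ.++-assoc w u u'
  in u ++ u' , λ { zero → ≡.subst (G zero) assoc g'
                 ; (suc i) → ≡.subst (G (suc i)) assoc (mono (suc i) u' (g i)) }

words : (k n : ℕ) → List (List (Fin k))
words k zero = []
words k (suc n) = [] ∷ cartesianProductWith _∷_ (allFin k) (words k n)

∈-words : ∀ {k n} (s : List (Fin k)) → length s < n → s ∈ words k n
∈-words [] (s≤s _) = here refl
∈-words (a ∷ s) (s≤s p) = there (∈ₚ.∈-cartesianProductWith⁺ _∷_ (∈ₚ.∈-allFin a) (∈-words s p))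

module Backward {A : Set} {N : ℕ} (δ : A → Fin N → Fin N) (final : Fin N → Fin 2) where

  residual : List A → Fin N → Fin 2
  residual s x = final (foldr δ x s)

  -- Reading s in front of a word acts through residual s, of which there are
  -- only 2 ^ N; so a long s can be cut between two prefixes with equal residuals.
  shorten : ∀ s → Acc _<_ (length s) →
            Σ[ s' ∈ List A ] (length s' < suc (2 ^ N)) × (∀ x → residual s' x ≡ residual s x)
  shorten s (accessible rs) with length s ℕ.<? suc (2 ^ N)
  ... | isYes p = s , p , λ _ → refl
  ... | isNo ¬p
    with i , j , i<j , eq ← Finₚ.pigeonhole (ℕₚ.n<1+n (2 ^ N)) (λ i → funToFin (residual (take (toℕ i) s)))
    = let s'' , p , e = shorten s' (rs shorter) in s'' , p , λ x → trans (e x) (cut x)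
    where
    s' = take (toℕ i) s ++ drop (toℕ j) s

    j≤ : toℕ j ≤ length s
    j≤ = ℕₚ.≤-trans (ℕₚ.<⇒≤ (Finₚ.toℕ<n j)) (ℕₚ.≮⇒≥ ¬p)

    shorter : length s' < length s
    shorter = begin-strict
      length s' ≡⟨ Listₚ.length-++ (take (toℕ i) s) ⟩
      length (take (toℕ i) s) ℕ.+ length (drop (toℕ j) s)
        ≡⟨ cong₂ ℕ._+_ (Listₚ.length-take (toℕ i) s) (Listₚ.length-drop (toℕ j) s) ⟩
      toℕ i ℕ.⊓ length s ℕ.+ (length s ℕ.∸ toℕ j) ≤⟨ ℕₚ.+-monoˡ-≤ (length s ℕ.∸ toℕ j) (ℕₚ.m⊓n≤m (toℕ i) (length s)) ⟩
      toℕ i ℕ.+ (length s ℕ.∸ toℕ j) <⟨ ℕₚ.+-monoˡ-< _ i<j ⟩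
      toℕ j ℕ.+ (length s ℕ.∸ toℕ j) ≡⟨ ℕₚ.m+[n∸m]≡n j≤ ⟩
      length s ∎
      where open ℕₚ.≤-Reasoning

    cut : ∀ x → residual s' x ≡ residual s x
    cut x = begin
      residual s' x ≡⟨ cong final (Listₚ.foldr-++ δ x (take (toℕ i) s) (drop (toℕ j) s)) ⟩
      residual (take (toℕ i) s) y ≡⟨ Finₚ.finToFun-funToFin (residual (take (toℕ i) s)) y ⟨
      finToFun (funToFin (residual (take (toℕ i) s))) y ≡⟨ cong (λ c → finToFun c y) eq ⟩
      finToFun (funToFin (residual (take (toℕ j) s))) y ≡⟨ Finₚ.finToFun-funToFin (residual (take (toℕ j) s)) y ⟩
      residual (take (toℕ j) s) y ≡⟨ cong final (Listₚ.foldr-++ δ x (take (toℕ j) s) (drop (toℕ j) s)) ⟨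
      residual (take (toℕ j) s ++ drop (toℕ j) s) x ≡⟨ cong (λ z → residual z x) (Listₚ.take++drop≡id (toℕ j) s) ⟩
      residual s x ∎
      where
      open ≡-Reasoning
      y = foldr δ x (drop (toℕ j) s)

module _ {k N : ℕ} (δ : Fin k → Fin N → Fin N) (final : Fin N → Fin 2) (start : Fin N) where

  open Backward δ final

  Accepts : List (Fin k) → Set
  Accepts w = residual w start ≡ suc zero

  residual-++ : ∀ s w → residual (s ++ w) start ≡ residual s (foldr δ start w)
  residual-++ s w = cong final (Listₚ.foldr-++ δ start s w)

  -- Acceptance of `s ++ w` depends on `s` only through `residual s`, so the words of length at most
  -- `2 ^ N` represent all prefixes. By `mono`, what has been achieved for one of them survives
  -- while `w` is extended for the next.
  synchronize : (∀ w u → Accepts w → Accepts (w ++ u)) → (∀ s → ∃[ u ] Accepts (s ++ u)) →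
                ∃[ w ] (∀ s → Accepts (s ++ w))
  synchronize mono ext = w , λ s →
    let s' , p , e = shorten s (<-wellFounded _)
        s'∈ = ∈-words s' p
    in trans (residual-++ s w) (trans (sym (e _)) (trans (sym (residual-++ s' w))
         (≡.subst (λ z → Accepts (z ++ w)) (sym (Anyₚ.lookup-index s'∈)) (good (Any.index s'∈)))))
    where
    L = words k (suc (2 ^ N))

    G : Fin (length L) → List (Fin k) → Set
    G i w = Accepts (lookup L i ++ w)

    step-mono : ∀ i {w} u → G i w → G i (w ++ u)
    step-mono i {w} u g = ≡.subst Accepts (Listₚ.++-assoc (lookup L i) w u) (mono (lookup L i ++ w) u g)

    step-ext : ∀ i w → ∃[ u ] G i (w ++ u)
    step-ext i w = let u , g = ext (lookup L i ++ w) in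
      u , ≡.subst Accepts (Listₚ.++-assoc (lookup L i) w u) g

    collected = collect G step-mono step-ext []
    w = proj₁ collected
    good = proj₂ collected

-- Verdicts of monitors as races between components

infix 4 _⊑_

_⊑_ : {A : Set} → List A → List A → Set
_⊑_ = Prefix _≡_

module _ {A : Set} where

  ⊑-refl : {u : List A} → u ⊑ u
  ⊑-refl {[]} = []
  ⊑-refl {a ∷ u} = refl ∷ ⊑-refl

  ⊑-trans : {u v w : List A} → u ⊑ v → v ⊑ w → u ⊑ w
  ⊑-trans = Prefixₚ.trans trans

  ⊑-++ : (u v : List A) → u ⊑ u ++ v
  ⊑-++ [] v = []
  ⊑-++ (a ∷ u) v = refl ∷ ⊑-++ u v

  ⊑-connex : {u v w : List A} → u ⊑ w → v ⊑ w → (u ⊑ v) ⊎ (v ⊑ u)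
  ⊑-connex [] _ = inj₁ []
  ⊑-connex (_ ∷ _) [] = inj₂ []
  ⊑-connex (refl ∷ p) (refl ∷ q) with ⊑-connex p q
  ... | inj₁ r = inj₁ (refl ∷ r)
  ... | inj₂ r = inj₂ (refl ∷ r)

-- The operators double as names of the two conclusive verdicts: abs o is the
-- verdict that is absorbing for o.
abs : Op → Verdict
abs ⊗ = no
abs ⊕ = yes

-- In mode step a component has to start with a visible action; this is the
-- situation below a choice or a recursion, which cannot fire τ.
data Mode : Set where
  now step : Mode

-- Only prefixes and verdicts act on their own; the actions of all other constructs are traced back
-- to these by the constructors of `Runs` and `Lasts`.
data Next {k : ℕ} (a : Act k) : Mon k 0 → Mon k 0 → Set where
  nact  : ∀ {m} → Next a (act a m) m
  nverd : ∀ {v} → Next a (verd v) (verd v)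

-- Runs μ m o u: m can reach the verdict abs o within u.  Lasts μ m u: m can
-- perform all of u.  The premise Lasts in rabsˡ and rabsʳ is the race at a
-- parallel composition: the other component must not get stuck earlier.
data Runs {k : ℕ} : Mode → Mon k 0 → Op → List (Act k) → Set
data Lasts {k : ℕ} : Mode → Mon k 0 → List (Act k) → Set

data Runs {k} where
  rverd : ∀ {v o u} → v ≡ abs o → Runs now (verd v) o u
  rnext : ∀ {μ m m' o a u} → Next a m m' → Runs now m' o u → Runs μ m o (a ∷ u)
  rabsˡ : ∀ {μ m n o u u'} → u' ⊑ u → Runs μ m o u' → Lasts μ n u' → Runs μ (par o m n) o u
  rabsʳ : ∀ {μ m n o u u'} → u' ⊑ u → Runs μ n o u' → Lasts μ m u' → Runs μ (par o m n) o u
  rboth : ∀ {μ m n o o' u} → Runs μ m o u → Runs μ n o u → Runs μ (par o' m n) o u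
  rselˡ : ∀ {μ m n o u} → Runs step m o u → Runs μ (m + n) o u
  rselʳ : ∀ {μ m n o u} → Runs step n o u → Runs μ (m + n) o u
  rrec  : ∀ {μ m o u} → Runs step (m [ rec m ]) o u → Runs μ (rec m) o u

data Lasts {k} where
  lnil  : ∀ {μ m} → Lasts μ m []
  lnext : ∀ {μ m m' a u} → Next a m m' → Lasts now m' u → Lasts μ m (a ∷ u)
  lboth : ∀ {μ m n o u} → Lasts μ m u → Lasts μ n u → Lasts μ (par o m n) u
  labsˡ : ∀ {μ m n o u u'} → u' ⊑ u → Runs μ m o u' → Lasts μ n u' → Lasts μ (par o m n) u
  labsʳ : ∀ {μ m n o u u'} → u' ⊑ u → Runs μ n o u' → Lasts μ m u' → Lasts μ (par o m n) u
  lselˡ : ∀ {μ m n u} → Lasts step m u → Lasts μ (m + n) u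
  lselʳ : ∀ {μ m n u} → Lasts step n u → Lasts μ (m + n) u
  lrec  : ∀ {μ m u} → Lasts step (m [ rec m ]) u → Lasts μ (rec m) u

module Timed {k : ℕ} where

  private variable
    m m' n : Mon k 0
    o : Op
    a : Act k
    u u' w : List (Act k)
    μ : Mode
    v : Verdict

  Runs-up : Runs μ m o u → u ⊑ u' → Runs μ m o u'
  Runs-up (rverd e) p = rverd e
  Runs-up (rnext x r) (refl ∷ p) = rnext x (Runs-up r p)
  Runs-up (rabsˡ q r l) p = rabsˡ (⊑-trans q p) r l
  Runs-up (rabsʳ q r l) p = rabsʳ (⊑-trans q p) r l
  Runs-up (rboth r s) p = rboth (Runs-up r p) (Runs-up s p)
  Runs-up (rselˡ r) p = rselˡ (Runs-up r p)
  Runs-up (rselʳ r) p = rselʳ (Runs-up r p)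
  Runs-up (rrec r) p = rrec (Runs-up r p)

  Lasts-verd : (u : List (Act k)) → Lasts μ (verd v) u
  Lasts-verd [] = lnil
  Lasts-verd (a ∷ u) = lnext nverd (Lasts-verd u)

  -- A verdict performs every action, so a monitor on its way to one is not stuck. At a composition,
  -- `u'` either covers the whole race, which the absorbing verdict has then settled, or stops
  -- within it, where both components still last.
  Runs-lasts : Runs μ m o u → u' ⊑ u → Lasts μ m u'
  Lasts-down : Lasts μ m u → u' ⊑ u → Lasts μ m u'

  Runs-lasts (rverd e) p = Lasts-verd _
  Runs-lasts (rnext x r) [] = lnil
  Runs-lasts (rnext x r) (refl ∷ p) = lnext x (Runs-lasts r p)
  Runs-lasts (rabsˡ q r l) p with ⊑-connex q p
  ... | inj₁ h = labsˡ h r l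
  ... | inj₂ h = lboth (Runs-lasts r h) (Lasts-down l h)
  Runs-lasts (rabsʳ q r l) p with ⊑-connex q p
  ... | inj₁ h = labsʳ h r l
  ... | inj₂ h = lboth (Lasts-down l h) (Runs-lasts r h)
  Runs-lasts (rboth r s) p = lboth (Runs-lasts r p) (Runs-lasts s p)
  Runs-lasts (rselˡ r) p = lselˡ (Runs-lasts r p)
  Runs-lasts (rselʳ r) p = lselʳ (Runs-lasts r p)
  Runs-lasts (rrec r) p = lrec (Runs-lasts r p)

  Lasts-down lnil [] = lnil
  Lasts-down (lnext x l) [] = lnil
  Lasts-down (lnext x l) (refl ∷ p) = lnext x (Lasts-down l p)
  Lasts-down (lboth l l') p = lboth (Lasts-down l p) (Lasts-down l' p)
  Lasts-down (labsˡ q r l) p with ⊑-connex q p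
  ... | inj₁ h = labsˡ h r l
  ... | inj₂ h = lboth (Runs-lasts r h) (Lasts-down l h)
  Lasts-down (labsʳ q r l) p with ⊑-connex q p
  ... | inj₁ h = labsʳ h r l
  ... | inj₂ h = lboth (Lasts-down l h) (Runs-lasts r h)
  Lasts-down (lselˡ l) p = lselˡ (Lasts-down l p)
  Lasts-down (lselʳ l) p = lselʳ (Lasts-down l p)
  Lasts-down (lrec l) p = lrec (Lasts-down l p)

  Runs-now : Runs step m o u → Runs now m o u
  Lasts-now : Lasts step m u → Lasts now m u
  Runs-now (rnext x r) = rnext x r
  Runs-now (rabsˡ q r l) = rabsˡ q (Runs-now r) (Lasts-now l)
  Runs-now (rabsʳ q r l) = rabsʳ q (Runs-now r) (Lasts-now l)
  Runs-now (rboth r s) = rboth (Runs-now r) (Runs-now s)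
  Runs-now (rselˡ r) = rselˡ r
  Runs-now (rselʳ r) = rselʳ r
  Runs-now (rrec r) = rrec r
  Lasts-now lnil = lnil
  Lasts-now (lnext x l) = lnext x l
  Lasts-now (lboth l l') = lboth (Lasts-now l) (Lasts-now l')
  Lasts-now (labsˡ q r l) = labsˡ q (Runs-now r) (Lasts-now l)
  Lasts-now (labsʳ q r l) = labsʳ q (Runs-now r) (Lasts-now l)
  Lasts-now (lselˡ l) = lselˡ l
  Lasts-now (lselʳ l) = lselʳ l
  Lasts-now (lrec l) = lrec l

  -- `Runs` and `Lasts` are carried backwards along a computation, from the verdict to its start. A
  -- visible transition yields mode `step`, as required below a choice or a recursion; a τ
  -- transition can only yield `now`.
  Runs-vis : m ─[ vis a ]→ m' → Runs now m' o u → Runs step m o (a ∷ u)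
  Lasts-vis : m ─[ vis a ]→ m' → Lasts now m' u → Lasts step m (a ∷ u)
  Runs-vis mAct r = rnext nact r
  Runs-vis mVerd r = rnext nverd r
  Runs-vis (mRec t) r = rrec (Runs-vis t r)
  Runs-vis (mSelL t) r = rselˡ (Runs-vis t r)
  Runs-vis (mSelR t) r = rselʳ (Runs-vis t r)
  Runs-vis (mPar t t') (rabsˡ q r l) = rabsˡ (refl ∷ q) (Runs-vis t r) (Lasts-vis t' l)
  Runs-vis (mPar t t') (rabsʳ q r l) = rabsʳ (refl ∷ q) (Runs-vis t' r) (Lasts-vis t l)
  Runs-vis (mPar t t') (rboth r s) = rboth (Runs-vis t r) (Runs-vis t' s)
  Lasts-vis mAct l = lnext nact l
  Lasts-vis mVerd l = lnext nverd l
  Lasts-vis (mRec t) l = lrec (Lasts-vis t l)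
  Lasts-vis (mSelL t) l = lselˡ (Lasts-vis t l)
  Lasts-vis (mSelR t) l = lselʳ (Lasts-vis t l)
  Lasts-vis (mPar t t') lnil = lboth (Lasts-vis t lnil) (Lasts-vis t' lnil)
  Lasts-vis (mPar t t') (lboth l l') = lboth (Lasts-vis t l) (Lasts-vis t' l')
  Lasts-vis (mPar t t') (labsˡ q r l) = labsˡ (refl ∷ q) (Runs-vis t r) (Lasts-vis t' l)
  Lasts-vis (mPar t t') (labsʳ q r l) = labsʳ (refl ∷ q) (Runs-vis t' r) (Lasts-vis t l)

  Runs-verd : Runs μ (verd v) o u → v ≡ abs o
  Runs-verd (rverd e) = e
  Runs-verd (rnext nverd r) = Runs-verd r

  Runs-τ : m ─[ τ ]→ m' → Runs now m' o u → Runs now m o u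
  Lasts-τ : m ─[ τ ]→ m' → Lasts now m' u → Lasts now m u
  Runs-τ (mTauL t) (rabsˡ q r l) = rabsˡ q (Runs-τ t r) l
  Runs-τ (mTauL t) (rabsʳ q r l) = rabsʳ q r (Lasts-τ t l)
  Runs-τ (mTauL t) (rboth r s) = rboth (Runs-τ t r) s
  Runs-τ (mTauR t) (rabsˡ q r l) = rabsˡ q r (Lasts-τ t l)
  Runs-τ (mTauR t) (rabsʳ q r l) = rabsʳ q (Runs-τ t r) l
  Runs-τ (mTauR t) (rboth r s) = rboth r (Runs-τ t s)
  Runs-τ mVrE r = rboth r r
  -- The verdict neutral for one operator is absorbing for the other. So the dropped component
  -- reappears either as an opponent that lasts for ever or as one that has itself reached `abs o`.
  Runs-τ {o = ⊗} mYesCL r = rabsʳ ⊑-refl r (Lasts-verd _)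
  Runs-τ {o = ⊕} mYesCL r = rboth (rverd refl) r
  Runs-τ {o = ⊗} mYesCR r = rabsˡ ⊑-refl r (Lasts-verd _)
  Runs-τ {o = ⊕} mYesCR r = rboth r (rverd refl)
  Runs-τ {o = ⊗} mNoCL r = rabsˡ [] (rverd refl) lnil
  Runs-τ {o = ⊕} mNoCL r with Runs-verd r
  ... | ()
  Runs-τ {o = ⊗} mNoCR r = rabsʳ [] (rverd refl) lnil
  Runs-τ {o = ⊕} mNoCR r with Runs-verd r
  ... | ()
  Runs-τ {o = ⊕} mNoDL r = rabsʳ ⊑-refl r (Lasts-verd _)
  Runs-τ {o = ⊗} mNoDL r = rboth (rverd refl) r
  Runs-τ {o = ⊕} mNoDR r = rabsˡ ⊑-refl r (Lasts-verd _)
  Runs-τ {o = ⊗} mNoDR r = rboth r (rverd refl)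
  Runs-τ {o = ⊕} mYesDL r = rabsˡ [] (rverd refl) lnil
  Runs-τ {o = ⊗} mYesDL r with Runs-verd r
  ... | ()
  Runs-τ {o = ⊕} mYesDR r = rabsʳ [] (rverd refl) lnil
  Runs-τ {o = ⊗} mYesDR r with Runs-verd r
  ... | ()
  Lasts-τ (mTauL t) lnil = lnil
  Lasts-τ (mTauL t) (lboth l l') = lboth (Lasts-τ t l) l'
  Lasts-τ (mTauL t) (labsˡ q r l) = labsˡ q (Runs-τ t r) l
  Lasts-τ (mTauL t) (labsʳ q r l) = labsʳ q r (Lasts-τ t l)
  Lasts-τ (mTauR t) lnil = lnil
  Lasts-τ (mTauR t) (lboth l l') = lboth l (Lasts-τ t l')
  Lasts-τ (mTauR t) (labsˡ q r l) = labsˡ q r (Lasts-τ t l)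
  Lasts-τ (mTauR t) (labsʳ q r l) = labsʳ q (Runs-τ t r) l
  Lasts-τ mVrE l = lboth l l
  Lasts-τ mYesCL l = lboth (Lasts-verd _) l
  Lasts-τ mYesCR l = lboth l (Lasts-verd _)
  Lasts-τ mNoCL l = labsˡ [] (rverd refl) lnil
  Lasts-τ mNoCR l = labsʳ [] (rverd refl) lnil
  Lasts-τ mNoDL l = lboth (Lasts-verd _) l
  Lasts-τ mNoDR l = lboth l (Lasts-verd _)
  Lasts-τ mYesDL l = labsˡ [] (rverd refl) lnil
  Lasts-τ mYesDR l = labsʳ [] (rverd refl) lnil

  ⇒-runs : m ⇒[ u ] verd (abs o) → Runs now m o u
  ⇒-runs wRefl = rverd refl
  ⇒-runs (wTau t d) = Runs-τ t (⇒-runs d)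
  ⇒-runs (wAct t d) = Runs-now (Runs-vis t (⇒-runs d))

  verd-⇒ : ∀ u → verd {k} {0} v ⇒[ u ] verd v
  verd-⇒ [] = wRefl
  verd-⇒ (a ∷ u) = wAct mVerd (verd-⇒ u)

  ⇒-verd-⊑ : m ⇒[ u ] verd v → u ⊑ u' → m ⇒[ u' ] verd v
  ⇒-verd-⊑ wRefl p = verd-⇒ _
  ⇒-verd-⊑ (wTau t d) p = wTau t (⇒-verd-⊑ d p)
  ⇒-verd-⊑ (wAct t d) (refl ∷ p) = wAct t (⇒-verd-⊑ d p)

  Reach : Mode → Mon k 0 → List (Act k) → Mon k 0 → Set
  Reach now m u n = m ⇒[ u ] n
  Reach step m [] n = ⊥
  Reach step m (a ∷ u) n = ∃[ m' ] (m ─[ vis a ]→ m') × (m' ⇒[ u ] n)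

  -- In mode `step` the empty word demands no transition and provides no derivative; the first
  -- disjunct covers this case.
  Survives : Mode → Mon k 0 → List (Act k) → Set
  Survives μ m u = (μ ≡ step × u ≡ []) ⊎ (∃[ n ] Reach μ m u n)

  Reach-next : Next a m m' → m' ⇒[ u ] n → Reach μ m (a ∷ u) n
  Reach-next {μ = now} nact d = wAct mAct d
  Reach-next {μ = now} nverd d = wAct mVerd d
  Reach-next {μ = step} nact d = _ , mAct , d
  Reach-next {μ = step} nverd d = _ , mVerd , d

  Reach-sim : (∀ {a n'} → m ─[ vis a ]→ n' → m' ─[ vis a ]→ n') → Reach step m u n → Reach μ m' u n
  Reach-sim {u = a ∷ u} {μ = now} f (_ , t , d) = wAct (f t) d
  Reach-sim {u = a ∷ u} {μ = step} f (_ , t , d) = _ , f t , d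

  Survives-[] : Survives μ m []
  Survives-[] {μ = now} = inj₂ (_ , wRefl)
  Survives-[] {μ = step} = inj₁ (refl , refl)

  Survives-sim : (∀ {a n'} → m ─[ vis a ]→ n' → m' ─[ vis a ]→ n') → Survives step m u → Survives μ m' u
  Survives-sim f (inj₁ (_ , refl)) = Survives-[]
  Survives-sim f (inj₂ (n , d)) = inj₂ (n , Reach-sim f d)

  par-⇒ : ∀ {m m' n n' : Mon k 0} → m ⇒[ u ] m' → n ⇒[ u ] n' → par o m n ⇒[ u ] par o m' n'
  par-⇒ (wTau t d) e = wTau (mTauL t) (par-⇒ d e)
  par-⇒ d (wTau t e) = wTau (mTauR t) (par-⇒ d e)
  par-⇒ wRefl wRefl = wRefl
  par-⇒ (wAct t d) (wAct t' e) = wAct (mPar t t') (par-⇒ d e)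

  Reach-par : ∀ {m m' n n' : Mon k 0} → Reach μ m u m' → Reach μ n u n' → Reach μ (par o m n) u (par o m' n')
  Reach-par {μ = now} d e = par-⇒ d e
  Reach-par {μ = step} {u = a ∷ u} (_ , t , d) (_ , t' , e) = _ , mPar t t' , par-⇒ d e

  Reach-τ : ∀ {m m' n : Mon k 0} → Reach μ m u m' → m' ─[ τ ]→ n → Reach μ m u n
  Reach-τ {μ = now} d t = ⇒-τ d
    where
    ⇒-τ : ∀ {m u} → m ⇒[ u ] _ → m ⇒[ u ] _
    ⇒-τ wRefl = wTau t wRefl
    ⇒-τ (wTau t' d) = wTau t' (⇒-τ d)
    ⇒-τ (wAct t' d) = wAct t' (⇒-τ d)
  Reach-τ {μ = step} {u = a ∷ u} (_ , t' , d) t = _ , t' , Reach-τ {μ = now} d t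

  Reach-verd-⊑ : Reach μ m u (verd v) → u ⊑ u' → Reach μ m u' (verd v)
  Reach-verd-⊑ {μ = now} d p = ⇒-verd-⊑ d p
  Reach-verd-⊑ {μ = step} (_ , t , d) (refl ∷ p) = _ , t , ⇒-verd-⊑ d p

  abs-τˡ : par o (verd (abs o)) m ─[ τ ]→ verd (abs o)
  abs-τˡ {o = ⊗} = mNoCL
  abs-τˡ {o = ⊕} = mYesDL

  abs-τʳ : par o m (verd (abs o)) ─[ τ ]→ verd (abs o)
  abs-τʳ {o = ⊗} = mNoCR
  abs-τʳ {o = ⊕} = mYesDR

  both-τ : ∀ {o o'} → par o' (verd (abs o)) (verd (abs o)) ─[ τ ]→ verd {k} {0} (abs o)
  both-τ {⊗} {⊗} = mNoCL
  both-τ {⊗} {⊕} = mNoDL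
  both-τ {⊕} {⊗} = mYesCL
  both-τ {⊕} {⊕} = mYesDL

  Reach-absˡ : Reach μ m u (verd (abs o)) → Survives μ n u → Reach μ (par o m n) u (verd (abs o))
  Reach-absˡ {μ = step} () (inj₁ (refl , refl))
  Reach-absˡ d (inj₂ (_ , e)) = Reach-τ (Reach-par d e) abs-τˡ

  Reach-absʳ : Reach μ n u (verd (abs o)) → Survives μ m u → Reach μ (par o m n) u (verd (abs o))
  Reach-absʳ {μ = step} () (inj₁ (refl , refl))
  Reach-absʳ d (inj₂ (_ , e)) = Reach-τ (Reach-par e d) abs-τʳ

  -- The converse of `⇒-runs`: a race is played on its own prefix `u'`, and the verdict absorbs the
  -- remainder of `u`.
  Runs-reach : Runs μ m o u → Reach μ m u (verd (abs o))
  Lasts-survives : Lasts μ m u → Survives μ m u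
  Runs-reach (rverd refl) = verd-⇒ _
  Runs-reach (rnext x r) = Reach-next x (Runs-reach r)
  Runs-reach (rabsˡ q r l) = Reach-verd-⊑ (Reach-absˡ (Runs-reach r) (Lasts-survives l)) q
  Runs-reach (rabsʳ q r l) = Reach-verd-⊑ (Reach-absʳ (Runs-reach r) (Lasts-survives l)) q
  Runs-reach (rboth r s) = Reach-τ (Reach-par (Runs-reach r) (Runs-reach s)) both-τ
  Runs-reach (rselˡ r) = Reach-sim mSelL (Runs-reach r)
  Runs-reach (rselʳ r) = Reach-sim mSelR (Runs-reach r)
  Runs-reach (rrec r) = Reach-sim mRec (Runs-reach r)
  Lasts-survives lnil = Survives-[]
  Lasts-survives (lnext x l) with Lasts-survives l
  ... | inj₂ (_ , d) = inj₂ (_ , Reach-next x d)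
  Lasts-survives (lboth l l') with Lasts-survives l | Lasts-survives l'
  ... | inj₁ (refl , refl) | _ = inj₁ (refl , refl)
  ... | inj₂ _ | inj₁ (refl , refl) = inj₁ (refl , refl)
  ... | inj₂ (_ , d) | inj₂ (_ , e) = inj₂ (_ , Reach-par d e)
  Lasts-survives (labsˡ q r l) = inj₂ (_ , Reach-verd-⊑ (Reach-absˡ (Runs-reach r) (Lasts-survives l)) q)
  Lasts-survives (labsʳ q r l) = inj₂ (_ , Reach-verd-⊑ (Reach-absʳ (Runs-reach r) (Lasts-survives l)) q)
  Lasts-survives (lselˡ l) = Survives-sim mSelL (Lasts-survives l)
  Lasts-survives (lselʳ l) = Survives-sim mSelR (Lasts-survives l)
  Lasts-survives (lrec l) = Survives-sim mRec (Lasts-survives l)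

open Timed

-- Equality and substitution of monitor terms

_≟ᵒ_ : DecidableEquality Op
⊗ ≟ᵒ ⊗ = isYes refl
⊗ ≟ᵒ ⊕ = isNo λ ()
⊕ ≟ᵒ ⊗ = isNo λ ()
⊕ ≟ᵒ ⊕ = isYes refl

_≟ᵛ_ : DecidableEquality Verdict
end ≟ᵛ end = isYes refl
end ≟ᵛ no = isNo λ ()
end ≟ᵛ yes = isNo λ ()
no ≟ᵛ end = isNo λ ()
no ≟ᵛ no = isYes refl
no ≟ᵛ yes = isNo λ ()
yes ≟ᵛ end = isNo λ ()
yes ≟ᵛ no = isNo λ ()
yes ≟ᵛ yes = isYes refl

_≟ᵐ_ : DecidableEquality Mode
now ≟ᵐ now = isYes refl
now ≟ᵐ step = isNo λ ()
step ≟ᵐ now = isNo λ ()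
step ≟ᵐ step = isYes refl

module _ {k : ℕ} where

  -- A partial equality test that is complete on the diagonal spares the
  -- off-diagonal cases of a full decision procedure.
  same : ∀ {d} (m n : Mon k d) → Maybe (m ≡ n)
  same (verd v) (verd v') = Maybe.map (cong verd) (dec⇒maybe (v ≟ᵛ v'))
  same (act a m) (act b n) = zipWith (cong₂ act) (dec⇒maybe (a Fin.≟ b)) (same m n)
  same (m + m') (n + n') = zipWith (cong₂ _+_) (same m n) (same m' n')
  same (par ⊗ m m') (par ⊗ n n') = zipWith (cong₂ (par ⊗)) (same m n) (same m' n')
  same (par ⊕ m m') (par ⊕ n n') = zipWith (cong₂ (par ⊕)) (same m n) (same m' n')
  same (rec m) (rec n) = Maybe.map (cong rec) (same m n)
  same (mvar i) (mvar j) = Maybe.map (cong mvar) (dec⇒maybe (i Fin.≟ j))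
  same _ _ = nothing

  same-refl : ∀ {d} (m : Mon k d) → same m m ≡ just refl
  same-refl (verd v) rewrite ≡-≟-identity _≟ᵛ_ {v} refl = refl
  same-refl (act a m) rewrite ≡-≟-identity Fin._≟_ {a} refl | same-refl m = refl
  same-refl (m + n) rewrite same-refl m | same-refl n = refl
  same-refl (par ⊗ m n) rewrite same-refl m | same-refl n = refl
  same-refl (par ⊕ m n) rewrite same-refl m | same-refl n = refl
  same-refl (rec m) rewrite same-refl m = refl
  same-refl (mvar i) rewrite ≡-≟-identity Fin._≟_ {i} refl = refl

  _≟ᴹ_ : ∀ {d} → DecidableEquality (Mon k d)
  m ≟ᴹ n with same m n in eq
  ... | just e = isYes e
  ... | nothing = isNo λ { refl → case-nothing (trans (sym eq) (same-refl m)) }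
    where
    case-nothing : ∀ {A : Set} {x : A} → nothing ≡ just x → ⊥
    case-nothing ()

  -- Under rec, Defs extends substitutions by pattern lambdas, which are only
  -- pointwise equal; hence the pointwise hypotheses.
  rename-rename : ∀ {d e f} {r : Fin d → Fin e} {r' : Fin e → Fin f} {r'' : Fin d → Fin f} →
                  (∀ i → r' (r i) ≡ r'' i) → (m : Mon k d) → rename r' (rename r m) ≡ rename r'' m
  rename-rename h (verd v) = refl
  rename-rename h (act a m) = cong (act a) (rename-rename h m)
  rename-rename h (m + n) = cong₂ _+_ (rename-rename h m) (rename-rename h n)
  rename-rename h (par o m n) = cong₂ (par o) (rename-rename h m) (rename-rename h n)
  rename-rename h (rec m) = cong rec (rename-rename (λ { zero → refl ; (suc i) → cong suc (h i) }) m)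
  rename-rename h (mvar i) = cong mvar (h i)

  subst-rename : ∀ {d e f} {r : Fin d → Fin e} {σ : Fin e → Mon k f} {τ : Fin d → Mon k f} →
                 (∀ i → σ (r i) ≡ τ i) → (m : Mon k d) → subst σ (rename r m) ≡ subst τ m
  subst-rename h (verd v) = refl
  subst-rename h (act a m) = cong (act a) (subst-rename h m)
  subst-rename h (m + n) = cong₂ _+_ (subst-rename h m) (subst-rename h n)
  subst-rename h (par o m n) = cong₂ (par o) (subst-rename h m) (subst-rename h n)
  subst-rename h (rec m) = cong rec (subst-rename (λ { zero → refl ; (suc i) → cong (rename suc) (h i) }) m)
  subst-rename h (mvar i) = h i

  rename-subst : ∀ {d e f} {σ : Fin d → Mon k e} {r : Fin e → Fin f} {τ : Fin d → Mon k f} →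
                 (∀ i → rename r (σ i) ≡ τ i) → (m : Mon k d) → rename r (subst σ m) ≡ subst τ m
  rename-subst h (verd v) = refl
  rename-subst h (act a m) = cong (act a) (rename-subst h m)
  rename-subst h (m + n) = cong₂ _+_ (rename-subst h m) (rename-subst h n)
  rename-subst h (par o m n) = cong₂ (par o) (rename-subst h m) (rename-subst h n)
  rename-subst {σ = σ} h (rec m) = cong rec (rename-subst
    (λ { zero → refl
       ; (suc i) → trans (trans (rename-rename (λ _ → refl) (σ i)) (sym (rename-rename (λ _ → refl) (σ i))))
                         (cong (rename suc) (h i)) }) m)
  rename-subst h (mvar i) = h i

  subst-subst : ∀ {d e f} {σ : Fin d → Mon k e} {τ : Fin e → Mon k f} {υ : Fin d → Mon k f} →
                (∀ i → subst τ (σ i) ≡ υ i) → (m : Mon k d) → subst τ (subst σ m) ≡ subst υ m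
  subst-subst h (verd v) = refl
  subst-subst h (act a m) = cong (act a) (subst-subst h m)
  subst-subst h (m + n) = cong₂ _+_ (subst-subst h m) (subst-subst h n)
  subst-subst h (par o m n) = cong₂ (par o) (subst-subst h m) (subst-subst h n)
  subst-subst {σ = σ} h (rec m) = cong rec (subst-subst
    (λ { zero → refl
       ; (suc i) → trans (trans (subst-rename (λ _ → refl) (σ i)) (sym (rename-subst (λ _ → refl) (σ i))))
                         (cong (rename suc) (h i)) }) m)
  subst-subst h (mvar i) = h i

  subst-id : ∀ {d} {σ : Fin d → Mon k d} → (∀ i → σ i ≡ mvar i) → (m : Mon k d) → subst σ m ≡ m
  subst-id h (verd v) = refl
  subst-id h (act a m) = cong (act a) (subst-id h m)
  subst-id h (m + n) = cong₂ _+_ (subst-id h m) (subst-id h n)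
  subst-id h (par o m n) = cong₂ (par o) (subst-id h m) (subst-id h n)
  subst-id h (rec m) = cong rec (subst-id (λ { zero → refl ; (suc i) → cong (rename suc) (h i) }) m)
  subst-id h (mvar i) = h i

  -- The finite set of subterms of a monitor

  _▹_ : ∀ {d} {A : Set} → (Fin d → A) → A → Fin (suc d) → A
  (σ ▹ n) zero = n
  (σ ▹ n) (suc i) = σ i

  -- Unfolding a recursion merely extends the substitution under which its body is read, so no new
  -- bodies arise. This keeps the closure finite.
  unfold-subst : ∀ {d} (σ : Fin d → Mon k 0) (m : Mon k (suc d)) {m' : Mon k 1} →
                 subst σ (rec m) ≡ rec m' → m' [ rec m' ] ≡ subst (σ ▹ rec m') m
  unfold-subst σ m refl = subst-subst
    (λ { zero → refl
       ; (suc i) → trans (subst-rename (λ _ → refl) (σ i)) (subst-id (λ ()) (σ i)) }) m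

  -- The analogue of the Fischer-Ladner closure: subterms with every variable replaced by the closed
  -- recursion that binds it. A variable adds nothing, since its value has been listed at the
  -- binder.
  closure : ∀ {d} → Mon k d → (Fin d → Mon k 0) → List (Mon k 0)
  closure (verd v) σ = verd v ∷ []
  closure (act a m) σ = subst σ (act a m) ∷ closure m σ
  closure (m + n) σ = subst σ (m + n) ∷ closure m σ ++ closure n σ
  closure (par o m n) σ = subst σ (par o m n) ∷ closure m σ ++ closure n σ
  closure (rec m) σ = subst σ (rec m) ∷ closure m (σ ▹ subst σ (rec m))
  closure (mvar i) σ = []

  Children∈ : List (Mon k 0) → Mon k 0 → Set
  Children∈ L (verd v) = ⊤
  Children∈ L (act a m) = m ∈ L
  Children∈ L (m + n) = m ∈ L × n ∈ L
  Children∈ L (par o m n) = m ∈ L × n ∈ L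
  Children∈ L (rec m) = m [ rec m ] ∈ L

  Closed : List (Mon k 0) → Set
  Closed L = ∀ {m} → m ∈ L → Children∈ L m

  module _ {L : List (Mon k 0)} where

    subst∈ : ∀ {d} (m : Mon k d) {σ} → (∀ i → σ i ∈ L) → (∀ {n} → n ∈ closure m σ → n ∈ L) → subst σ m ∈ L
    subst∈ (verd v) h c = c (here refl)
    subst∈ (act a m) h c = c (here refl)
    subst∈ (m + n) h c = c (here refl)
    subst∈ (par o m n) h c = c (here refl)
    subst∈ (rec m) h c = c (here refl)
    subst∈ (mvar i) h c = h i

    ▹∈ : ∀ {d} {σ : Fin d → Mon k 0} {n} → (∀ i → σ i ∈ L) → n ∈ L → ∀ i → (σ ▹ n) i ∈ L
    ▹∈ h p zero = p
    ▹∈ h p (suc i) = h i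

    -- The children are located in a larger list `L`, because a child that is a variable becomes a
    -- value of `σ`, listed outside `closure m σ`.
    closure-closed : ∀ {d} (m : Mon k d) {σ} → (∀ i → σ i ∈ L) → (∀ {n} → n ∈ closure m σ → n ∈ L) →
                     ∀ {n} → n ∈ closure m σ → Children∈ L n
    closure-closed (verd v) h c (here refl) = _
    closure-closed (act a m) h c (here refl) = subst∈ m h (c ∘ there)
    closure-closed (act a m) h c (there p) = closure-closed m h (c ∘ there) p
    closure-closed (m + n) h c (here refl) =
      subst∈ m h (c ∘ there ∘ ∈ₚ.∈-++⁺ˡ) , subst∈ n h (c ∘ there ∘ ∈ₚ.∈-++⁺ʳ (closure m _))
    closure-closed (m + n) {σ} h c (there p) with ∈ₚ.∈-++⁻ (closure m σ) p
    ... | inj₁ q = closure-closed m h (c ∘ there ∘ ∈ₚ.∈-++⁺ˡ) q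
    ... | inj₂ q = closure-closed n h (c ∘ there ∘ ∈ₚ.∈-++⁺ʳ (closure m σ)) q
    closure-closed (par o m n) h c (here refl) =
      subst∈ m h (c ∘ there ∘ ∈ₚ.∈-++⁺ˡ) , subst∈ n h (c ∘ there ∘ ∈ₚ.∈-++⁺ʳ (closure m _))
    closure-closed (par o m n) {σ} h c (there p) with ∈ₚ.∈-++⁻ (closure m σ) p
    ... | inj₁ q = closure-closed m h (c ∘ there ∘ ∈ₚ.∈-++⁺ˡ) q
    ... | inj₂ q = closure-closed n h (c ∘ there ∘ ∈ₚ.∈-++⁺ʳ (closure m σ)) q
    closure-closed (rec m) {σ} h c (here refl) rewrite unfold-subst σ m refl =
      subst∈ m (▹∈ h (c (here refl))) (c ∘ there)
    closure-closed (rec m) h c (there p) = closure-closed m (▹∈ h (c (here refl))) (c ∘ there) p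

  -- `verd end` is added as the monitor of the opponent `stop`.
  subterms : Mon k 0 → List (Mon k 0)
  subterms m = verd end ∷ closure m (λ ())

  subterms-closed : (m : Mon k 0) → Closed (subterms m)
  subterms-closed m (here refl) = _
  subterms-closed m (there p) = closure-closed m (λ ()) there p

  ∈-subterms : (m : Mon k 0) → m ∈ subterms m
  ∈-subterms m = ≡.subst (_∈ subterms m) (subst-id (λ ()) m) (subst∈ m {σ = λ ()} (λ ()) there)

-- Races between subterms as an inductive system of facts

Node : ℕ → Set
Node k = Mode × Mon k 0

-- The fact (x , o , y): x reaches abs o within some prefix that y can perform.
Fact : ℕ → Set
Fact k = Node k × Op × Node k

module Races {k : ℕ} where

  -- `end` performs every word without concluding, so a race against it is plain reachability of the
  -- verdict.
  stop : Node k
  stop = now , verd end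

  RuleX : (Fact k → Set) → Fact k → Set
  RuleX J ((μ , verd v) , o , y) = μ ≡ now × v ≡ abs o
  RuleX J ((μ , act a m) , o , y) = ⊥
  RuleX J ((μ , m + n) , o , y) = J ((step , m) , o , y) ⊎ J ((step , n) , o , y)
  RuleX J ((μ , par o' m n) , o , y) =
      (o' ≡ o × J ((μ , m) , o , (μ , n)) × J ((μ , m) , o , y))
    ⊎ (o' ≡ o × J ((μ , n) , o , (μ , m)) × J ((μ , n) , o , y))
    ⊎ (J ((μ , m) , o , y) × J ((μ , n) , o , y))
  RuleX J ((μ , rec m) , o , y) = J ((step , m [ rec m ]) , o , y)

  -- If one component of `y` beats the other, the composition turns into a verdict and never gets
  -- stuck, so only the run of `x` is left to ask for, a race against `stop`. Should `x` finish
  -- earlier, both components last until then.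
  RuleY : (Fact k → Set) → Fact k → Set
  RuleY J (x , o , (μ , verd v)) = ⊥
  RuleY J (x , o , (μ , act a m)) = ⊥
  RuleY J (x , o , (μ , m + n)) = J (x , o , (step , m)) ⊎ J (x , o , (step , n))
  RuleY J (x , o , (μ , par o' m n)) =
      (J (x , o , (μ , m)) × J (x , o , (μ , n)))
    ⊎ (J ((μ , m) , o' , (μ , n)) × J (x , o , stop))
    ⊎ (J ((μ , n) , o' , (μ , m)) × J (x , o , stop))
  RuleY J (x , o , (μ , rec m)) = J (x , o , (step , m [ rec m ]))

  Rule : (Fact k → Set) → (Fact k → Set) → Fact k → Set
  Rule B J f = B f ⊎ RuleX J f ⊎ RuleY J f

  -- The rules consume no action and may run in circles, as on `rec (mvar zero)`; hence a least
  -- fixed point instead of a recursion on terms.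
  data Close (B : Fact k → Set) : Fact k → Set where
    close : ∀ {f} → Rule B (Close B) f → Close B f

  data After (a : Act k) (J : Fact k → Set) : Fact k → Set where
    after : ∀ {μ ν m m' n n' o} → Next a m m' → Next a n n' → J ((now , m') , o , (now , n')) →
            After a J ((μ , m) , o , (ν , n))

  Der : List (Act k) → Fact k → Set
  Der [] = Close (λ _ → ⊥)
  Der (a ∷ w) = Close (After a (Der w))

  private variable
    m n : Mon k 0
    o : Op
    a : Act k
    u u' w : List (Act k)
    μ ν : Mode
    v : Verdict
    x y : Node k

  der-X : ∀ w → RuleX (Der w) (x , o , y) → Der w (x , o , y)
  der-X [] r = close (inj₂ (inj₁ r))
  der-X (a ∷ w) r = close (inj₂ (inj₁ r))

  der-Y : ∀ w → RuleY (Der w) (x , o , y) → Der w (x , o , y)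
  der-Y [] r = close (inj₂ (inj₂ r))
  der-Y (a ∷ w) r = close (inj₂ (inj₂ r))

  Runs-stop : Runs μ m o u → u ⊑ w → Der w ((μ , m) , o , stop)
  -- Keeping `u'` apart from `u` lets the recursion use the given `Lasts` derivation as it is,
  -- without `Lasts-down`. The side `x` is decomposed first, and `y` only when `x` waits for an
  -- action, because `After` moves both sides at once.
  Runs-der : Runs μ m o u → Lasts ν n u' → u ⊑ u' → u' ⊑ w → Der w ((μ , m) , o , (ν , n))
  Runs-stop (rverd e) q = der-X _ (refl , e)
  Runs-stop (rnext x r) (refl ∷ q) = close (inj₁ (after x nverd (Runs-stop r q)))
  Runs-stop (rabsˡ p r l) q = der-X _ (inj₁ (refl , Runs-der r l ⊑-refl (⊑-trans p q) , Runs-stop r (⊑-trans p q)))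
  Runs-stop (rabsʳ p r l) q = der-X _ (inj₂ (inj₁ (refl , Runs-der r l ⊑-refl (⊑-trans p q) , Runs-stop r (⊑-trans p q))))
  Runs-stop (rboth r s) q = der-X _ (inj₂ (inj₂ (Runs-stop r q , Runs-stop s q)))
  Runs-stop (rselˡ r) q = der-X _ (inj₁ (Runs-stop r q))
  Runs-stop (rselʳ r) q = der-X _ (inj₂ (Runs-stop r q))
  Runs-stop (rrec r) q = der-X _ (Runs-stop r q)
  Runs-der (rverd e) l p q = der-X _ (refl , e)
  Runs-der (rabsˡ p' r l') l p q = der-X _ (inj₁ (refl ,
    Runs-der r l' ⊑-refl (⊑-trans p' (⊑-trans p q)) , Runs-der r l (⊑-trans p' p) q))
  Runs-der (rabsʳ p' r l') l p q = der-X _ (inj₂ (inj₁ (refl ,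
    Runs-der r l' ⊑-refl (⊑-trans p' (⊑-trans p q)) , Runs-der r l (⊑-trans p' p) q)))
  Runs-der (rboth r s) l p q = der-X _ (inj₂ (inj₂ (Runs-der r l p q , Runs-der s l p q)))
  Runs-der (rselˡ r) l p q = der-X _ (inj₁ (Runs-der r l p q))
  Runs-der (rselʳ r) l p q = der-X _ (inj₂ (Runs-der r l p q))
  Runs-der (rrec r) l p q = der-X _ (Runs-der r l p q)
  Runs-der (rnext x r) (lnext y l) (refl ∷ p) (refl ∷ q) = close (inj₁ (after x y (Runs-der r l p q)))
  Runs-der r@(rnext _ _) (lboth l l') p q = der-Y _ (inj₁ (Runs-der r l p q , Runs-der r l' p q))
  Runs-der r@(rnext _ _) (labsˡ p' r' l') p q =
    der-Y _ (inj₂ (inj₁ (Runs-der r' l' ⊑-refl (⊑-trans p' q) , Runs-stop r (⊑-trans p q))))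
  Runs-der r@(rnext _ _) (labsʳ p' r' l') p q =
    der-Y _ (inj₂ (inj₂ (Runs-der r' l' ⊑-refl (⊑-trans p' q) , Runs-stop r (⊑-trans p q))))
  Runs-der r@(rnext _ _) (lselˡ l) p q = der-Y _ (inj₁ (Runs-der r l p q))
  Runs-der r@(rnext _ _) (lselʳ l) p q = der-Y _ (inj₂ (Runs-der r l p q))
  Runs-der r@(rnext _ _) (lrec l) p q = der-Y _ (Runs-der r l p q)

  Race : List (Act k) → Fact k → Set
  Race w ((μ , m) , o , (ν , n)) = ∃[ u ] (u ⊑ w) × Runs μ m o u × Lasts ν n u

  close-race : ∀ {B f} → (∀ {f} → B f → Race w f) → Close B f → Race w f
  close-race h (close (inj₁ b)) = h b
  close-race {f = (_ , verd v) , o , y} h (close (inj₂ (inj₁ (refl , e)))) = [] , [] , rverd e , lnil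
  close-race {f = (_ , m + n) , o , y} h (close (inj₂ (inj₁ (inj₁ d)))) =
    let u , p , r , l = close-race h d in u , p , rselˡ r , l
  close-race {f = (_ , m + n) , o , y} h (close (inj₂ (inj₁ (inj₂ d)))) =
    let u , p , r , l = close-race h d in u , p , rselʳ r , l
  close-race {f = (_ , rec m) , o , y} h (close (inj₂ (inj₁ d))) =
    let u , p , r , l = close-race h d in u , p , rrec r , l
  close-race {f = (_ , par _ m n) , o , y} h (close (inj₂ (inj₁ (inj₁ (refl , d , e)))))
    with close-race h d | close-race h e
  ... | u , p , r , l | u' , p' , r' , l' with ⊑-connex p p'
  ...   | inj₁ q = u , p , rabsˡ ⊑-refl r l , Lasts-down l' q
  ...   | inj₂ q = u' , p' , rabsˡ ⊑-refl r' (Lasts-down l q) , l'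
  close-race {f = (_ , par _ m n) , o , y} h (close (inj₂ (inj₁ (inj₂ (inj₁ (refl , d , e))))))
    with close-race h d | close-race h e
  ... | u , p , r , l | u' , p' , r' , l' with ⊑-connex p p'
  ...   | inj₁ q = u , p , rabsʳ ⊑-refl r l , Lasts-down l' q
  ...   | inj₂ q = u' , p' , rabsʳ ⊑-refl r' (Lasts-down l q) , l'
  -- Here both runs must be over, so the longer prefix is taken; that `y` lasts it is part of the
  -- race that supplied it.
  close-race {f = (_ , par _ m n) , o , y} h (close (inj₂ (inj₁ (inj₂ (inj₂ (d , e))))))
    with close-race h d | close-race h e
  ... | u , p , r , l | u' , p' , r' , l' with ⊑-connex p p'
  ...   | inj₁ q = u' , p' , rboth (Runs-up r q) r' , l'
  ...   | inj₂ q = u , p , rboth r (Runs-up r' q) , l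
  close-race {f = x , o , (_ , m + n)} h (close (inj₂ (inj₂ (inj₁ d)))) =
    let u , p , r , l = close-race h d in u , p , r , lselˡ l
  close-race {f = x , o , (_ , m + n)} h (close (inj₂ (inj₂ (inj₂ d)))) =
    let u , p , r , l = close-race h d in u , p , r , lselʳ l
  close-race {f = x , o , (_ , rec m)} h (close (inj₂ (inj₂ d))) =
    let u , p , r , l = close-race h d in u , p , r , lrec l
  close-race {f = x , o , (_ , par _ m n)} h (close (inj₂ (inj₂ (inj₁ (d , e)))))
    with close-race h d | close-race h e
  ... | u , p , r , l | u' , p' , r' , l' with ⊑-connex p p'
  ...   | inj₁ q = u , p , r , lboth l (Lasts-down l' q)
  ...   | inj₂ q = u' , p' , r' , lboth (Lasts-down l q) l'
  close-race {f = x , o , (_ , par _ m n)} h (close (inj₂ (inj₂ (inj₂ (inj₁ (d , e))))))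
    with close-race h d | close-race h e
  ... | u , p , r , l | u' , p' , r' , _ with ⊑-connex p p'
  ...   | inj₁ q = u' , p' , r' , labsˡ q r l
  ...   | inj₂ q = u' , p' , r' , lboth (Runs-lasts r q) (Lasts-down l q)
  close-race {f = x , o , (_ , par _ m n)} h (close (inj₂ (inj₂ (inj₂ (inj₂ (d , e))))))
    with close-race h d | close-race h e
  ... | u , p , r , l | u' , p' , r' , _ with ⊑-connex p p'
  ...   | inj₁ q = u' , p' , r' , labsʳ q r l
  ...   | inj₂ q = u' , p' , r' , lboth (Lasts-down l q) (Runs-lasts r q)

  der-race : ∀ w {f} → Der w f → Race w f
  der-race [] = close-race λ ()
  der-race (a ∷ w) = close-race λ
    { (after x y d) → let u , p , r , l = der-race w d in a ∷ u , refl ∷ p , rnext x r , lnext y l }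

  ⇒-der : m ⇒[ w ] verd (abs o) → Der w ((now , m) , o , stop)
  ⇒-der d = Runs-stop (⇒-runs d) ⊑-refl

  der-⇒ : ∀ w → Der w ((now , m) , o , stop) → m ⇒[ w ] verd (abs o)
  der-⇒ w d = let u , p , r , _ = der-race w d in ⇒-verd-⊑ (Runs-reach r) p

open Races

-- The backward automaton: sets of facts as states

module Table {A : Set} (_≟_ : DecidableEquality A) (F : List A) where

  K : ℕ
  K = length F

  State : Set
  State = Fin (2 ^ K)

  Holds : State → A → Set
  Holds x f = ∃[ i ] (finToFun x i ≡ suc zero) × (lookup F i ≡ f)

  holds? : ∀ x f → Dec (Holds x f)
  holds? x f = Finₚ.any? λ i → (finToFun x i Fin.≟ suc zero) ×-dec (lookup F i ≟ f)

  bit : {P : Set} → Dec P → Fin 2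
  bit (isYes _) = suc zero
  bit (isNo _) = zero

  bit⇒ : ∀ {P} (P? : Dec P) → bit P? ≡ suc zero → P
  bit⇒ (isYes p) _ = p

  ⇒bit : ∀ {P} (P? : Dec P) → P → bit P? ≡ suc zero
  ⇒bit (isYes _) _ = refl
  ⇒bit (isNo ¬p) p = ⊥-elim (¬p p)

  module Encode {P : A → Set} (P? : ∀ {f} → f ∈ F → Dec (P f)) where

    bits : Fin K → Fin 2
    bits i = bit (P? (∈ₚ.∈-lookup i))

    -- Unfolding the state space Fin (2 ^ K) would make type checking explode.
    abstract
      encode : State
      encode = funToFin bits

      holds⇒ : ∀ {f} → Holds encode f → P f
      holds⇒ (i , e , refl) = bit⇒ (P? _) (trans (sym (Finₚ.finToFun-funToFin bits i)) e)

      ⇒holds : ∀ {f} → f ∈ F → P f → Holds encode f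
      ⇒holds w p = Any.index w ,
        trans (Finₚ.finToFun-funToFin bits (Any.index w)) (⇒bit (P? _) (≡.subst P (Anyₚ.lookup-index w) p)) ,
        sym (Anyₚ.lookup-index w)

module _ {k : ℕ} where

  _≟ᴺ_ : DecidableEquality (Node k)
  _≟ᴺ_ = Productₚ.≡-dec _≟ᵐ_ _≟ᴹ_

  _≟ᶠ_ : DecidableEquality (Fact k)
  _≟ᶠ_ = Productₚ.≡-dec _≟ᴺ_ (Productₚ.≡-dec _≟ᵒ_ _≟ᴺ_)

  open Dec∈ _≟ᶠ_ using (_∈?_)

  next? : ∀ (a : Act k) m → Dec (∃[ m' ] Next a m m')
  next? a (verd v) = isYes (_ , nverd)
  next? a (act b m) with a Fin.≟ b
  ... | isYes refl = isYes (_ , nact)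
  ... | isNo a≢b = isNo λ { (_ , nact) → a≢b refl }
  next? a (m + n) = isNo λ ()
  next? a (par o m n) = isNo λ ()
  next? a (rec m) = isNo λ ()

  next-unique : ∀ {a : Act k} {m m' m''} → Next a m m' → Next a m m'' → m' ≡ m''
  next-unique nact nact = refl
  next-unique nverd nverd = refl

  after? : ∀ {a J} → (∀ f → Dec (J f)) → ∀ f → Dec (After {k} a J f)
  after? {a} {J} J? ((μ , m) , o , (ν , n)) with next? a m | next? a n
  ... | isNo ¬x | _ = isNo λ { (after x _ _) → ¬x (_ , x) }
  ... | isYes _ | isNo ¬y = isNo λ { (after _ y _) → ¬y (_ , y) }
  ... | isYes (m' , x) | isYes (n' , y) = map′ (after x y) unafter (J? ((now , m') , o , (now , n')))
    where
    unafter : After a J ((μ , m) , o , (ν , n)) → J ((now , m') , o , (now , n'))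
    unafter (after x' y' j) = ≡.subst₂ (λ p q → J ((now , p) , o , (now , q))) (next-unique x' x) (next-unique y' y) j

  ruleX? : ∀ {J} → (∀ f → Dec (J f)) → ∀ f → Dec (RuleX {k} J f)
  ruleX? J? ((μ , verd v) , o , y) = (μ ≟ᵐ now) ×-dec (v ≟ᵛ abs o)
  ruleX? J? ((μ , act a m) , o , y) = isNo id
  ruleX? J? ((μ , m + n) , o , y) = J? _ ⊎-dec J? _
  ruleX? J? ((μ , par o' m n) , o , y) =
    ((o' ≟ᵒ o) ×-dec (J? _ ×-dec J? _)) ⊎-dec (((o' ≟ᵒ o) ×-dec (J? _ ×-dec J? _)) ⊎-dec (J? _ ×-dec J? _))
  ruleX? J? ((μ , rec m) , o , y) = J? _

  ruleY? : ∀ {J} → (∀ f → Dec (J f)) → ∀ f → Dec (RuleY {k} J f)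
  ruleY? J? (x , o , (μ , verd v)) = isNo id
  ruleY? J? (x , o , (μ , act a m)) = isNo id
  ruleY? J? (x , o , (μ , m + n)) = J? _ ⊎-dec J? _
  ruleY? J? (x , o , (μ , par o' m n)) = (J? _ ×-dec J? _) ⊎-dec ((J? _ ×-dec J? _) ⊎-dec (J? _ ×-dec J? _))
  ruleY? J? (x , o , (μ , rec m)) = J? _

  rule? : ∀ {B J} → (∀ f → Dec (B f)) → (∀ f → Dec (J f)) → ∀ f → Dec (Rule {k} B J f)
  rule? B? J? f = B? f ⊎-dec (ruleX? J? f ⊎-dec ruleY? J? f)

  ruleX-map : ∀ {J J' : Fact k → Set} → (∀ {f} → J f → J' f) → ∀ f → RuleX J f → RuleX J' f
  ruleX-map h ((μ , verd v) , o , y) r = r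
  ruleX-map h ((μ , m + n) , o , y) = Sum.map h h
  ruleX-map h ((μ , par o' m n) , o , y) =
    Sum.map (Product.map₂ (Product.map h h)) (Sum.map (Product.map₂ (Product.map h h)) (Product.map h h))
  ruleX-map h ((μ , rec m) , o , y) = h

  ruleY-map : ∀ {J J' : Fact k → Set} → (∀ {f} → J f → J' f) → ∀ f → RuleY J f → RuleY J' f
  ruleY-map h (x , o , (μ , m + n)) = Sum.map h h
  ruleY-map h (x , o , (μ , par o' m n)) = Sum.map (Product.map h h) (Sum.map (Product.map h h) (Product.map h h))
  ruleY-map h (x , o , (μ , rec m)) = h

  module Facts (m₀ : Mon k 0) where

    L : List (Mon k 0)
    L = subterms m₀

    nodes : List (Node k)
    nodes = cartesianProduct (now ∷ step ∷ []) L

    facts : List (Fact k)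
    facts = cartesianProduct nodes (cartesianProduct (⊗ ∷ ⊕ ∷ []) nodes)

    Within : Fact k → Set
    Within ((μ , m) , o , (ν , n)) = m ∈ L × n ∈ L

    within-∈ : ∀ {f} → Within f → f ∈ facts
    within-∈ {(μ , m) , o , (ν , n)} (p , q) =
      ∈ₚ.∈-cartesianProduct⁺ (∈ₚ.∈-cartesianProduct⁺ (mode μ) p)
        (∈ₚ.∈-cartesianProduct⁺ (op o) (∈ₚ.∈-cartesianProduct⁺ (mode ν) q))
      where
      mode : ∀ μ → μ ∈ now ∷ step ∷ []
      mode now = here refl
      mode step = there (here refl)
      op : ∀ o → o ∈ ⊗ ∷ ⊕ ∷ []
      op ⊗ = here refl
      op ⊕ = there (here refl)

    ∈-within : ∀ {f} → f ∈ facts → Within f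
    ∈-within p with ∈ₚ.∈-cartesianProduct⁻ nodes (cartesianProduct (⊗ ∷ ⊕ ∷ []) nodes) p
    ... | x , q with ∈ₚ.∈-cartesianProduct⁻ (⊗ ∷ ⊕ ∷ []) nodes q
    ...   | _ , y = proj₂ (∈ₚ.∈-cartesianProduct⁻ (now ∷ step ∷ []) L x)
                  , proj₂ (∈ₚ.∈-cartesianProduct⁻ (now ∷ step ∷ []) L y)

    -- Induction on `Close` confined to finitely many facts: the premises of a rule mention only
    -- children of its terms and `stop`, so `alg` is never asked about a term outside `L`.
    module Fold {B J : Fact k → Set} (alg : ∀ {f} → Within f → Rule B J f → J f) where

      fold : ∀ f → Within f → Close B f → J f
      foldX : ∀ f → Within f → RuleX (Close B) f → RuleX J f
      foldY : ∀ f → Within f → RuleY (Close B) f → RuleY J f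

      fold f i (close (inj₁ b)) = alg i (inj₁ b)
      fold f i (close (inj₂ (inj₁ r))) = alg i (inj₂ (inj₁ (foldX f i r)))
      fold f i (close (inj₂ (inj₂ r))) = alg i (inj₂ (inj₂ (foldY f i r)))

      foldX ((μ , verd v) , o , y) i r = r
      foldX ((μ , m + n) , o , y) (i , i') r with subterms-closed m₀ i
      foldX ((μ , m + n) , o , y) (i , i') (inj₁ r) | p , q = inj₁ (fold _ (p , i') r)
      foldX ((μ , m + n) , o , y) (i , i') (inj₂ r) | p , q = inj₂ (fold _ (q , i') r)
      foldX ((μ , par o' m n) , o , y) (i , i') r with subterms-closed m₀ i
      foldX ((μ , par o' m n) , o , y) (i , i') (inj₁ (e , r , s)) | p , q =
        inj₁ (e , fold _ (p , q) r , fold _ (p , i') s)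
      foldX ((μ , par o' m n) , o , y) (i , i') (inj₂ (inj₁ (e , r , s))) | p , q =
        inj₂ (inj₁ (e , fold _ (q , p) r , fold _ (q , i') s))
      foldX ((μ , par o' m n) , o , y) (i , i') (inj₂ (inj₂ (r , s))) | p , q =
        inj₂ (inj₂ (fold _ (p , i') r , fold _ (q , i') s))
      foldX ((μ , rec m) , o , y) (i , i') r = fold _ (subterms-closed m₀ i , i') r

      foldY (x , o , (μ , m + n)) (i , i') r with subterms-closed m₀ i'
      foldY (x , o , (μ , m + n)) (i , i') (inj₁ r) | p , q = inj₁ (fold _ (i , p) r)
      foldY (x , o , (μ , m + n)) (i , i') (inj₂ r) | p , q = inj₂ (fold _ (i , q) r)
      foldY (x , o , (μ , par o' m n)) (i , i') r with subterms-closed m₀ i'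
      foldY (x , o , (μ , par o' m n)) (i , i') (inj₁ (r , s)) | p , q =
        inj₁ (fold _ (i , p) r , fold _ (i , q) s)
      foldY (x , o , (μ , par o' m n)) (i , i') (inj₂ (inj₁ (r , s))) | p , q =
        inj₂ (inj₁ (fold _ (p , q) r , fold _ (i , here refl) s))
      foldY (x , o , (μ , par o' m n)) (i , i') (inj₂ (inj₂ (r , s))) | p , q =
        inj₂ (inj₂ (fold _ (q , p) r , fold _ (i , here refl) s))
      foldY (x , o , (μ , rec m)) (i , i') r = fold _ (i , subterms-closed m₀ i') r

    close-map : ∀ {B B'} → (∀ {f} → Within f → B f → B' f) → ∀ {f} → Within f → Close B f → Close B' f
    close-map {B} {B'} h = Fold.fold alg _
      where
      alg : ∀ {f} → Within f → Rule B (Close B') f → Close B' f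
      alg i = close ∘ Sum.map₁ (h i)

    module _ {B : Fact k → Set} (B? : ∀ f → Dec (B f)) where

      -- One applicable conclusion at a time moves from `R` to `S`, so the length of `R` bounds the
      -- iteration. Membership in the result decides `Close B` on `facts`: the result is derivable
      -- and, being closed under the rules, contains everything derivable there.
      saturate : ∀ n (R S : List (Fact k)) → length R ≡ n → (∀ {f} → f ∈ S → Close B f) →
                 (∀ {f} → f ∈ facts → f ∈ S ⊎ f ∈ R) →
                 ∃[ S' ] (∀ {f} → f ∈ S' → Close B f) × (∀ {f} → f ∈ facts → Rule B (_∈ S') f → f ∈ S')
      saturate n R S e snd cov with Any.any? (rule? B? (_∈? S)) R
      ... | isNo ¬r = S , snd , λ p r → Sum.[ id , (λ q → ⊥-elim (¬r (lose q r))) ]′ (cov p)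
      ... | isYes r with find r
      ...   | f , f∈R , rf with ∈ₚ.∈-∃++ f∈R
      saturate zero R S e snd cov | isYes _ | f , f∈R , rf | ys , zs , refl
        with () ← trans (sym (Listₚ.length-++-sucʳ ys f zs)) e
      saturate (suc n) R S e snd cov | isYes _ | f , f∈R , rf | ys , zs , refl =
        saturate n (ys ++ zs) (f ∷ S) (ℕₚ.suc-injective (trans (sym (Listₚ.length-++-sucʳ ys f zs)) e))
          (λ { (here refl) → derivable ; (there p) → snd p }) cov'
        where
        derivable : Close B f
        derivable = close (Sum.map₂ (Sum.map (ruleX-map snd f) (ruleY-map snd f)) rf)
        cov' : ∀ {g} → g ∈ facts → g ∈ f ∷ S ⊎ g ∈ ys ++ zs
        cov' p with cov p
        ... | inj₁ q = inj₁ (there q)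
        ... | inj₂ q with ∈ₚ.∈-++⁻ ys q
        ...   | inj₁ q' = inj₂ (∈ₚ.∈-++⁺ˡ q')
        ...   | inj₂ (here refl) = inj₁ (here refl)
        ...   | inj₂ (there q') = inj₂ (∈ₚ.∈-++⁺ʳ ys q')

      abstract
        close? : ∀ {f} → f ∈ facts → Dec (Close B f)
        close? {f} p with saturate (length facts) facts [] refl (λ ()) inj₂
        ... | S , snd , closed with f ∈? S
        ...   | isYes q = isYes (snd q)
        ...   | isNo ¬q = isNo (¬q ∘ Fold.fold (λ i → closed (within-∈ i)) _ (∈-within p))

    open Table _≟ᶠ_ facts
    open Encode

    initial : State
    initial = encode (close? (λ _ → isNo id))

    δ : Act k → State → State
    δ a x = encode (close? (after? {a = a} (holds? x)))

    next-within : ∀ {a m m'} → m ∈ L → Next a m m' → m' ∈ L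
    next-within p nact = subterms-closed m₀ p
    next-within p nverd = p

    after-map : ∀ {a J J'} → (∀ {f} → Within f → J f → J' f) → ∀ {f} → Within f → After a J f → After a J' f
    after-map h (p , q) (after x y j) = after x y (h (next-within p x , next-within q y) j)

    -- With `der-holds`, the state after reading `w` is exactly `Der w` cut down to `facts`.
    -- `Within` is carried along because the table is silent about other facts.
    holds-der : ∀ w {f} → Within f → Holds (foldr δ initial w) f → Der w f
    holds-der [] p h = holds⇒ (close? (λ _ → isNo id)) h
    holds-der (a ∷ w) p h = close-map (after-map (holds-der w)) p (holds⇒ (close? (after? (holds? _))) h)

    der-holds : ∀ w {f} → Within f → Der w f → Holds (foldr δ initial w) f
    der-holds [] p d = ⇒holds (close? (λ _ → isNo id)) (within-∈ p) d
    der-holds (a ∷ w) p d = ⇒holds (close? (after? (holds? _))) (within-∈ p) (close-map (after-map (der-holds w)) p d)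

  verdict-synchronize : ∀ (m : Mon k 0) o → (∀ s → ∃[ u ] (m ⇒[ s ++ u ] verd (abs o))) →
                        ∃[ w ] (∀ s → m ⇒[ s ++ w ] verd (abs o))
  verdict-synchronize m o ext =
    let w , h = synchronize δ final initial
                  (λ w u h → ⇒-accepts (⇒-verd-⊑ (accepts-⇒ w h) (⊑-++ w u)))
                  (λ s → let u , d = ext s in u , ⇒-accepts d)
    in w , λ s → accepts-⇒ (s ++ w) (h s)
    where
    open Facts m
    open Table _≟ᶠ_ facts
    goal : Fact k
    goal = (now , m) , o , stop

    goal-within : Within goal
    goal-within = ∈-subterms m , here refl

    final : State → Fin 2
    final x = bit (holds? x goal)

    accepts-⇒ : ∀ w → Accepts δ final initial w → m ⇒[ w ] verd (abs o)
    accepts-⇒ w h = der-⇒ w (holds-der w goal-within (bit⇒ (holds? _ goal) h))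

    ⇒-accepts : ∀ {w} → m ⇒[ w ] verd (abs o) → Accepts δ final initial w
    ⇒-accepts {w} d = ⇒bit (holds? _ goal) (der-holds w goal-within (⇒-der d))

-- From monitors to words and back

module _ {k : ℕ} where

  -- Function extensionality is unavailable, so "t = w · t'" is not usable for
  -- infinite t; Starts w t replaces it.
  Starts : List (Act k) → Trace k → Set
  Starts [] t = ⊤
  Starts (a ∷ w) = Dia a (Starts w)

  starts-fin : ∀ w {l} → Starts w (fin l) → w ⊑ l
  starts-fin [] h = []
  starts-fin (a ∷ w) {b ∷ l} (refl , h) = refl ∷ starts-fin w h

  fin-starts : ∀ {w l} → w ⊑ l → Starts w (fin l)
  fin-starts [] = _
  fin-starts (refl ∷ p) = refl , fin-starts p

  starts-inf : ∀ w {g} → Starts w (inf g) → prefix (length w) g ≡ w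
  starts-inf [] h = refl
  starts-inf (a ∷ w) (refl , h) = cong (_ ∷_) (starts-inf w h)

  inf-starts : ∀ {w} n {g} → w ⊑ prefix n g → Starts w (inf g)
  inf-starts {[]} n p = _
  inf-starts {a ∷ w} (suc n) (refl ∷ p) = refl , inf-starts n p

  Concludes : Verdict → Mon k 0 → Trace k → Set
  Concludes v m (fin l) = m ⇒[ l ] verd v
  Concludes v m (inf g) = ∃[ n ] (m ⇒[ prefix n g ] verd v)

  starts-concludes : ∀ {v m} w t → m ⇒[ w ] verd v → Starts w t → Concludes v m t
  starts-concludes w (fin l) d h = ⇒-verd-⊑ d (starts-fin w h)
  starts-concludes w (inf g) d h = length w , ≡.subst (_ ⇒[_] _) (sym (starts-inf w h)) d

  ·-fin : ∀ s l → s · fin l ≡ fin {k} (s ++ l)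
  ·-fin [] l = refl
  ·-fin (a ∷ s) l = cong (cons a) (·-fin s l)

  ·-inf : ∀ s g → ∃[ h ] (s · inf g ≡ inf {k} h) × (∀ n → prefix (length s ℕ.+ n) h ≡ s ++ prefix n g)
  ·-inf [] g = g , refl , λ n → refl
  ·-inf (a ∷ s) g with s · inf g | ·-inf s g
  ... | _ | h , refl , e = _ , refl , λ n → cong (a ∷_) (e n)

  prefix-⊑ : ∀ {n n'} g → n ≤ n' → prefix {k} n g ⊑ prefix n' g
  prefix-⊑ g z≤n = []
  prefix-⊑ g (s≤s p) = refl ∷ prefix-⊑ _ p

  concludes-extend : ∀ {v m} s f → Concludes v m (s · f) → ∃[ u ] (m ⇒[ s ++ u ] verd v)
  concludes-extend s (fin l) c rewrite ·-fin s l = l , c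
  concludes-extend s (inf g) c with s · inf g | ·-inf s g
  concludes-extend s (inf g) (n , d) | _ | h , refl , e =
    -- The verdict may already fall inside `s`; reading `length s + n` actions makes the word an
    -- extension of `s`, and the verdict persists.
    prefix n g , ≡.subst (_ ⇒[_] _) (e n) (⇒-verd-⊑ d (prefix-⊑ h (ℕₚ.m≤n+m n (length s))))

  monitor-word : ∀ m o → (∀ s → Σ[ f ∈ Trace k ] Concludes (abs o) m (s · f)) →
                 ∃[ w ] (∀ s t → Starts (s ++ w) t → Concludes (abs o) m t)
  monitor-word m o pi =
    let w , h = verdict-synchronize m o (λ s → let f , c = pi s in concludes-extend s f c)
    in w , λ s t → starts-concludes (s ++ w) t (h s)

  spell : ∀ {d} → Verdict → List (Act k) → Mon k d
  spell v [] = verd v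
  spell v (a ∷ w) = act a (spell v w)

  -- There is no empty choice; `verd end` takes its place and never becomes conclusive. It accounts
  -- for the disjunct `v' ≡ end` in `seeker-sound`.
  skip : List (Act k) → Mon k 1
  skip [] = verd end
  skip (b ∷ bs) = act b (mvar zero) + skip bs

  -- The first letter is guessed nondeterministically; the empty word needs a
  -- separate case because a recursion cannot conclude before the first action.
  seeker : Verdict → List (Act k) → Mon k 0
  seeker v [] = verd v
  seeker v w@(_ ∷ _) = rec (skip (allFin k) + spell v w)

  subst-spell : ∀ {d e} {σ : Fin d → Mon k e} v w → subst σ (spell v w) ≡ spell v w
  subst-spell v [] = refl
  subst-spell v (a ∷ w) = cong (act a) (subst-spell v w)

  spell-complete : ∀ v w → spell v w ⇒[ w ] verd v
  spell-complete v [] = wRefl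
  spell-complete v (a ∷ w) = wAct mAct (spell-complete v w)

  skip-complete : ∀ {σ : Fin 1 → Mon k 0} {a bs} → a ∈ bs → subst σ (skip bs) ─[ vis a ]→ σ zero
  skip-complete (here refl) = mSelL mAct
  skip-complete (there p) = mSelR (skip-complete p)

  seeker-complete : ∀ v w s → seeker v w ⇒[ s ++ w ] verd v
  seeker-complete v [] s = verd-⇒ _
  seeker-complete v (a ∷ w) [] =
    wAct (mRec (mSelR mAct)) (≡.subst (_⇒[ w ] verd v) (sym (subst-spell v w)) (spell-complete v w))
  seeker-complete v w@(_ ∷ _) (b ∷ s) =
    wAct (mRec (mSelL (skip-complete (∈ₚ.∈-allFin b)))) (seeker-complete v w s)

  spell-sound : ∀ {v v'} w {u} → spell v w ⇒[ u ] verd v' → v' ≡ v × w ⊑ u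
  spell-sound [] wRefl = refl , []
  spell-sound [] (wAct mVerd d) = Product.map₂ (λ _ → []) (spell-sound [] d)
  spell-sound (a ∷ w) (wAct mAct d) = Product.map₂ (refl ∷_) (spell-sound w d)

  skip-sound : ∀ {σ : Fin 1 → Mon k 0} {a n} bs → subst σ (skip bs) ─[ vis a ]→ n → n ≡ σ zero ⊎ n ≡ verd end
  skip-sound [] mVerd = inj₂ refl
  skip-sound (b ∷ bs) (mSelL mAct) = inj₁ refl
  skip-sound (b ∷ bs) (mSelR t) = skip-sound bs t

  seeker-sound : ∀ {v v'} w {u} → seeker v w ⇒[ u ] verd v' → v' ≡ end ⊎ (v' ≡ v × ∃[ s ] (s ++ w ⊑ u))
  seeker-sound [] d = inj₂ (proj₁ (spell-sound [] d) , [] , [])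
  seeker-sound w@(_ ∷ _) (wAct (mRec (mSelL t)) d) with skip-sound (allFin k) t
  -- `verd end` is `spell end []`.
  ... | inj₂ refl = inj₁ (proj₁ (spell-sound [] d))
  ... | inj₁ refl = Sum.map₂ (Product.map₂ λ { (s , p) → _ ∷ s , refl ∷ p }) (seeker-sound w d)
  seeker-sound {v} (a ∷ w) (wAct (mRec (mSelR mAct)) d) =
    let e , p = spell-sound w (≡.subst (_⇒[ _ ] _) (subst-spell v w) d) in inj₂ (e , [] , refl ∷ p)

  seeker-concludes : ∀ {v v'} w t → Concludes v' (seeker v w) t → v' ≡ end ⊎ (v' ≡ v × ∃[ s ] Starts (s ++ w) t)
  seeker-concludes w (fin l) d = Sum.map₂ (Product.map₂ (Product.map₂ fin-starts)) (seeker-sound w d)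
  seeker-concludes w (inf g) (n , d) = Sum.map₂ (Product.map₂ (Product.map₂ (inf-starts n))) (seeker-sound w d)

  seeker-pi : ∀ v w s → Concludes v (seeker v w) (s · fin w)
  seeker-pi v w s rewrite ·-fin s w = seeker-complete v w s

-- Synchronizing words of formula trees

-- The common shape of a formula of sHML ∩ eHML and of its dual in cHML ∩ eHML:
-- leaf is ff resp. tt, node is ∧ resp. ∨, and fix is max resp. min.
data Tree (k : ℕ) : ℕ → Set where
  leaf : ∀ {d} → Tree k d
  var  : ∀ {d} → Fin d → Tree k d
  node : ∀ {d} → Tree k d → Tree k d → Tree k d
  box  : ∀ {d} → (Act k → Tree k d) → Tree k d
  fix  : ∀ {d} → Tree k (suc d) → Tree k d

module Trees {k : ℕ} where

  private variable
    d : ℕ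
    T : Tree k d
    w : List (Act k)

  OnNext : (Act k → Trace k → Set₁) → Trace k → Set₁
  OnNext V (fin []) = Lift _ ⊥
  OnNext V (fin (a ∷ l)) = V a (fin l)
  OnNext V (inf g) = V (g zero) (inf (λ i → g (suc i)))

  -- Ver follows the cHML reading, in which reaching a leaf is success; for
  -- sHML it is the condition for refutation.
  Ver : Tree k d → Env k d → Trace k → Set₁
  Ver leaf ρ t = Lift _ ⊤
  Ver (var i) ρ t = Lift _ (ρ i t)
  Ver (node T T') ρ t = Ver T ρ t ⊎ Ver T' ρ t
  Ver (box f) ρ t = OnNext (λ a → Ver (f a) ρ) t
  Ver (fix T) ρ t = (P : Pred₀ k) → (∀ t' → Ver T (extend P ρ) t' → P t') → P t

  -- A path through the tree that reads `u` and exits at a leaf or a free variable. In `hfix`,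
  -- `Maybe.map suc` excludes ending at the variable just bound, which would only lead back to the
  -- start.
  data Hit : Tree k d → List (Act k) → Maybe (Fin d) → Set where
    hleaf : Hit (leaf {d = d}) [] nothing
    hvar  : ∀ {i : Fin d} → Hit (var i) [] (just i)
    hl    : ∀ {T T' : Tree k d} {u x} → Hit T u x → Hit (node T T') u x
    hr    : ∀ {T T' : Tree k d} {u x} → Hit T' u x → Hit (node T T') u x
    hbox  : ∀ {f : Act k → Tree k d} {a u x} → Hit (f a) u x → Hit (box f) (a ∷ u) x
    hfix  : ∀ {T : Tree k (suc d)} {u x} → Hit T u (Maybe.map suc x) → Hit (fix T) u x

  Hits : Tree k d → Set
  Hits T = ∃₂ (Hit T)

  Ung : Tree k d → Fin d → Set
  Ung leaf i = ⊥
  Ung (var j) i = j ≡ i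
  Ung (node T T') i = Ung T i ⊎ Ung T' i
  Ung (box f) i = ⊥
  Ung (fix T) i = Ung T (suc i)

  -- `Hits` is demanded only where it is not inherited: leaves and variables are exits themselves,
  -- and a node has the exits of its left subtree.
  Live : Tree k d → Set
  Live leaf = ⊤
  Live (var i) = ⊤
  Live (node T T') = Live T × Live T'
  Live (box f) = Hits (box f) × (∀ a → Live (f a))
  Live (fix T) = Hits (fix T) × ¬ Ung T zero × Live T

  data Ctx : ℕ → Set where
    ∅ : Ctx 0
    _▸_ : Ctx d → Tree k (suc d) → Ctx (suc d)

  data Fits : Ctx d → Env k d → Set₁ where
    ∅ : ∀ {ρ} → Fits ∅ ρ
    _▸_ : ∀ {Γ : Ctx d} {T ρ P} → Fits Γ ρ → (∀ t → Ver T (extend P ρ) t → P t) → Fits (Γ ▸ T) (extend P ρ)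

  record Forces (w : List (Act k)) (Γ : Ctx d) (T : Tree k d) : Set₁ where
    constructor forces
    field verifies : ∀ {ρ} → Fits Γ ρ → ∀ t → Starts w t → Ver T ρ t

  open Forces

  starts-++ : ∀ w u {t} → Starts {k} (w ++ u) t → Starts w t
  starts-++ [] u h = _
  starts-++ (a ∷ w) u {fin (b ∷ l)} (e , h) = e , starts-++ w u h
  starts-++ (a ∷ w) u {inf g} (e , h) = e , starts-++ w u h

  forces-++ : ∀ {w Γ} {T : Tree k d} u → Forces w Γ T → Forces (w ++ u) Γ T
  forces-++ {w = w} u F .verifies φ t h = F .verifies φ t (starts-++ w u h)

  forces-leaf : ∀ {w} {Γ : Ctx d} → Forces w Γ leaf
  forces-leaf .verifies _ _ _ = _

  forces-nodeˡ : ∀ {w} {Γ : Ctx d} {T T'} → Forces w Γ T → Forces w Γ (node T T')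
  forces-nodeˡ F .verifies φ t h = inj₁ (F .verifies φ t h)

  forces-nodeʳ : ∀ {w} {Γ : Ctx d} {T T'} → Forces w Γ T' → Forces w Γ (node T T')
  forces-nodeʳ F .verifies φ t h = inj₂ (F .verifies φ t h)

  forces-box : ∀ {Γ : Ctx d} {f a w} → Forces w Γ (f a) → Forces (a ∷ w) Γ (box f)
  forces-box F .verifies φ (fin (b ∷ l)) (refl , h) = F .verifies φ (fin l) h
  forces-box F .verifies φ (inf g) (refl , h) = F .verifies φ (inf (λ i → g (suc i))) h

  forces-fix : ∀ {w} {Γ : Ctx d} {T} → Forces w (Γ ▸ T) T → Forces w Γ (fix T)
  forces-fix F .verifies φ t h P pre = pre t (F .verifies (φ ▸ pre) t h)

  -- `Ver (fix T)` speaks about every prefixed point, and the value of the variable is one of them.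
  forces-zero : ∀ {w} {Γ : Ctx d} {T} → Forces w Γ (fix T) → Forces w (Γ ▸ T) (var zero)
  forces-zero F .verifies (φ ▸ pre) t h = lift (F .verifies φ t h _ pre)

  forces-suc : ∀ {w} {Γ : Ctx d} {T i} → Forces w Γ (var i) → Forces w (Γ ▸ T) (var (suc i))
  forces-suc F .verifies (φ ▸ pre) t h = lift (Lift.lower (F .verifies φ t h))

  hit-nothing : ∀ {Γ} {T : Tree k d} {u} → Hit T u nothing → Forces u Γ T
  hit-nothing hleaf = forces-leaf
  hit-nothing (hl H) = forces-nodeˡ (hit-nothing H)
  hit-nothing (hr H) = forces-nodeʳ (hit-nothing H)
  hit-nothing (hbox H) = forces-box (hit-nothing H)
  hit-nothing (hfix H) = forces-fix (hit-nothing H)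

  hit-just : ∀ {Γ} {T : Tree k d} {u u' i} → Hit T u (just i) → Forces u' Γ (var i) → Forces (u ++ u') Γ T
  hit-just hvar F = F
  hit-just (hl H) F = forces-nodeˡ (hit-just H F)
  hit-just (hr H) F = forces-nodeʳ (hit-just H F)
  hit-just (hbox H) F = forces-box (hit-just H F)
  hit-just (hfix H) F = forces-fix (hit-just H (forces-suc F))

  hits-forces : ∀ {Γ} {T : Tree k d} → (∀ i → ∃[ u ] Forces u Γ (var i)) → Hits T → ∃[ u ] Forces u Γ T
  hits-forces κ (u , nothing , H) = u , hit-nothing H
  hits-forces κ (u , just i , H) = let u' , F = κ i in u ++ u' , hit-just H F

  Property : Set₂
  Property = ∀ {d} → Ctx d → Tree k d → Set₁

  Each : Property → ∀ {d} → Ctx d → Tree k d → Set₁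
  Each Q Γ leaf = Q Γ leaf
  Each Q Γ (var i) = Q Γ (var i)
  Each Q Γ (node T T') = Q Γ (node T T') × Each Q Γ T × Each Q Γ T'
  Each Q Γ (box f) = Q Γ (box f) × (∀ a → Each Q Γ (f a))
  Each Q Γ (fix T) = Q Γ (fix T) × Each Q (Γ ▸ T) T

  each-head : ∀ {Q : Property} {Γ} (T : Tree k d) → Each Q Γ T → Q Γ T
  each-head leaf q = q
  each-head (var i) q = q
  each-head (node T T') (q , _) = q
  each-head (box f) (q , _) = q
  each-head (fix T) (q , _) = q

  each-map : ∀ {Q R : Property} → (∀ {d} {Γ} {T : Tree k d} → Q Γ T → R Γ T) → ∀ {Γ} (T : Tree k d) → Each Q Γ T → Each R Γ T
  each-map h leaf q = h q
  each-map h (var i) q = h q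
  each-map h (node T T') (q , l , r) = h q , each-map h T l , each-map h T' r
  each-map h (box f) (q , c) = h q , λ a → each-map h (f a) (c a)
  each-map h (fix T) (q , c) = h q , each-map h T c

  -- Used with C trivial (every s extends to a forcing word) and with C = (_≡ w)
  -- (one word w works after every s).
  Extends : (List (Act k) → Set) → List (Act k) → Property
  Extends C s Γ T = Σ[ u ∈ List (Act k) ] (C u × Forces (s ++ u) Γ T)

  Arbitrary : List (Act k) → Set
  Arbitrary _ = ⊤

  -- The argument proceeds from the outer binders inwards: when a subtree is reached, each of its
  -- free variables already has the word found for its `fix`, so any exit will do.
  each-base : ∀ {Γ} (T : Tree k d) → Live T → (∀ i → ∃[ u ] Forces u Γ (var i)) → Each (Extends Arbitrary []) Γ T
  each-base leaf _ κ = [] , _ , forces-leaf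
  each-base (var i) _ κ = let u , F = κ i in u , _ , F
  each-base (node T T') (l , l') κ =
    let L = each-base T l κ ; u , _ , F = each-head T L
    in (u , _ , forces-nodeˡ F) , L , each-base T' l' κ
  each-base (box f) (H , l) κ =
    let u , F = hits-forces κ H in (u , _ , F) , λ a → each-base (f a) (l a) κ
  each-base (fix T) (H , _ , l) κ =
    let u , F = hits-forces κ H
    in (u , _ , F) , each-base T l λ { zero → u , forces-zero F ; (suc i) → Product.map₂ forces-suc (κ i) }

  module _ {C : List (Act k) → Set} {s : List (Act k)} (a : Act k) where

    -- By guardedness, the way down from the root meets a leaf, a box or an outer variable without
    -- passing through a loop. At a box the action `a` leads to a subtree for which `s` has been
    -- dealt with; `κ` serves the outer variables.
    head-step : ∀ {Γ} (T : Tree k d) → Live T → (∀ i → Ung T i → Extends C (a ∷ s) Γ (var i)) →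
                Each (Extends C s) Γ T → Extends C (a ∷ s) Γ T
    head-step leaf _ κ (u , c , F) = u , c , forces-leaf
    head-step (var i) _ κ E = κ i refl
    head-step (node T T') (l , _) κ (_ , E , _) =
      let u , c , F = head-step T l (λ i p → κ i (inj₁ p)) E in u , c , forces-nodeˡ F
    head-step (box f) _ κ (_ , E) =
      let u , c , F = each-head (f a) (E a) in u , c , forces-box F
    head-step (fix T) (_ , g , l) κ (_ , E) =
      let u , c , F = head-step T l (λ { zero p → ⊥-elim (g p)
                                       ; (suc i) p → Product.map₂ (Product.map₂ forces-suc) (κ i p) }) E
      in u , c , forces-fix F

    each-step : ∀ {Γ} (T : Tree k d) → Live T → (∀ i → Extends C (a ∷ s) Γ (var i)) →
                Each (Extends C s) Γ T → Each (Extends C (a ∷ s)) Γ T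
    each-step leaf l κ E = head-step leaf l (λ i _ → κ i) E
    each-step (var i) l κ E = κ i
    each-step (node T T') (l , l') κ E@(_ , e , e') =
      head-step (node T T') (l , l') (λ i _ → κ i) E , each-step T l κ e , each-step T' l' κ e'
    each-step (box f) (H , l) κ E@(_ , e) =
      head-step (box f) (H , l) (λ i _ → κ i) E , λ b → each-step (f b) (l b) κ (e b)
    each-step (fix T) (H , g , l) κ E@(_ , e) =
      let X@(u , c , F) = head-step (fix T) (H , g , l) (λ i _ → κ i) E
      in X , each-step T l (λ { zero → u , c , forces-zero F
                              ; (suc i) → Product.map₂ (Product.map₂ forces-suc) (κ i) }) e

  -- Induction on `s` goes through only for all subtrees at once: removing the first action leaves
  -- the root for some other subtree.
  each-after : ∀ {C} (T : Tree k 0) → Live T → Each (Extends C []) ∅ T → ∀ s → Each (Extends C s) ∅ T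
  each-after T l E [] = E
  each-after T l E (a ∷ s) = each-step a T l (λ ()) (each-after T l E s)

  each-++ : ∀ {Γ} (T : Tree k d) {w} u → Each (Forces w) Γ T → Each (Forces (w ++ u)) Γ T
  each-++ T u = each-map (forces-++ u) T

  append : (A B : List (Act k) → Set₁) → (∀ {w} u → A w → A (w ++ u)) →
           (∀ w → Σ[ u ∈ List (Act k) ] A (w ++ u)) → (∀ w → Σ[ u ∈ List (Act k) ] B (w ++ u)) →
           ∀ w → Σ[ u ∈ List (Act k) ] (A (w ++ u) × B (w ++ u))
  append A B mono f g w =
    let u , p = f w ; u' , q = g (w ++ u) ; e = Listₚ.++-assoc w u u'
    in u ++ u' , ≡.subst A e (mono u' p) , ≡.subst B e q

  module _ {Γ : Ctx d} (T : Tree k d) (R : List (Act k) → Set₁)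
           (E : ∀ s → Each (Extends Arbitrary s) Γ T) where

    with-head : (∀ w → Σ[ u ∈ List (Act k) ] R (w ++ u)) →
                ∀ w → Σ[ u ∈ List (Act k) ] (Forces (w ++ u) Γ T × R (w ++ u))
    with-head = append (λ w → Forces w Γ T) R (λ u → forces-++ u)
      λ w → let u , _ , F = each-head T (E w) in u , F

  gather : ∀ {Γ} (T : Tree k d) → (∀ s → Each (Extends Arbitrary s) Γ T) →
           ∀ w → Σ[ u ∈ List (Act k) ] Each (Forces (w ++ u)) Γ T
  gather leaf E w = [] , forces-leaf
  gather (var i) E w = let u , _ , F = E w in u , F
  gather (node T T') E = with-head (node T T') (λ w → Each (Forces w) _ T × Each (Forces w) _ T') E
    (append (λ w → Each (Forces w) _ T) (λ w → Each (Forces w) _ T') (each-++ T)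
      (gather T λ s → proj₁ (proj₂ (E s))) (gather T' λ s → proj₂ (proj₂ (E s))))
  gather (box f) E = with-head (box f) (λ w → ∀ a → Each (Forces w) _ (f a)) E
    (collect (λ a w → Each (Forces w) _ (f a)) (λ a → each-++ (f a)) (λ a → gather (f a) λ s → proj₂ (E s) a))
  gather (fix T) E = with-head (fix T) (λ w → Each (Forces w) _ T) E (gather T λ s → proj₂ (E s))

  tree-word : (T : Tree k 0) → Live T → ∃[ w ] (∀ s t → Starts (s ++ w) t → Ver T emptyEnv t)
  tree-word T l = word , λ s t h →
    -- `word` so far forces every subtree directly; a second use of `each-after`, with the extension
    -- fixed to be `word`, places it behind an arbitrary `s`.
    let u , e , F = each-head T (each-after {C = _≡ word} T l (each-map (λ F → word , refl , F) T all) s)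
    in F .verifies ∅ t (≡.subst (λ z → Starts (s ++ z) t) (sym e) h)
    where
    found = gather T (each-after T l (each-base T l λ ())) []
    word = proj₁ found
    all = proj₂ found

open Trees

-- Properties of iterated conjunctions and disjunctions

module _ {k d : ℕ} {ℓ : Level} (X : Fml k d → Set ℓ) where

  -- The argument of type `Fin m` excludes the empty conjunction `tt`, about which the hypotheses
  -- say nothing.
  bigAnd-intro : (∀ {φ ψ} → X φ → X ψ → X (φ ∧ ψ)) →
                 ∀ {m} (g : Fin m → Fml k d) → Fin m → (∀ i → X (g i)) → X (bigAnd g)
  bigAnd-intro h {suc zero} g _ x = x zero
  bigAnd-intro h {suc (suc m)} g _ x = h (x zero) (bigAnd-intro h (g ∘ suc) zero (x ∘ suc))

  bigOr-intro : (∀ {φ ψ} → X φ → X ψ → X (φ ∨ ψ)) →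
                ∀ {m} (g : Fin m → Fml k d) → Fin m → (∀ i → X (g i)) → X (bigOr g)
  bigOr-intro h {suc zero} g _ x = x zero
  bigOr-intro h {suc (suc m)} g _ x = h (x zero) (bigOr-intro h (g ∘ suc) zero (x ∘ suc))

  bigAnd-inject : (∀ {φ ψ} → X φ ⊎ X ψ → X (φ ∧ ψ)) →
                  ∀ {m} (g : Fin m → Fml k d) i → X (g i) → X (bigAnd g)
  bigAnd-inject h {suc zero} g zero x = x
  bigAnd-inject h {suc (suc m)} g zero x = h (inj₁ x)
  bigAnd-inject h {suc (suc m)} g (suc i) x = h (inj₂ (bigAnd-inject h (g ∘ suc) i x))

  bigOr-inject : (∀ {φ ψ} → X φ ⊎ X ψ → X (φ ∨ ψ)) →
                 ∀ {m} (g : Fin m → Fml k d) i → X (g i) → X (bigOr g)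
  bigOr-inject h {suc zero} g zero x = x
  bigOr-inject h {suc (suc m)} g zero x = h (inj₁ x)
  bigOr-inject h {suc (suc m)} g (suc i) x = h (inj₂ (bigOr-inject h (g ∘ suc) i x))

  bigAnd-all : (∀ {φ ψ} → X (φ ∧ ψ) → X φ × X ψ) →
               ∀ {m} (g : Fin m → Fml k d) → X (bigAnd g) → ∀ i → X (g i)
  bigAnd-all h {suc zero} g x zero = x
  bigAnd-all h {suc (suc m)} g x zero = proj₁ (h x)
  bigAnd-all h {suc (suc m)} g x (suc i) = bigAnd-all h (g ∘ suc) (proj₂ (h x)) i

  bigOr-all : (∀ {φ ψ} → X (φ ∨ ψ) → X φ × X ψ) →
              ∀ {m} (g : Fin m → Fml k d) → X (bigOr g) → ∀ i → X (g i)
  bigOr-all h {suc zero} g x zero = x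
  bigOr-all h {suc (suc m)} g x zero = proj₁ (h x)
  bigOr-all h {suc (suc m)} g x (suc i) = bigOr-all h (g ∘ suc) (proj₂ (h x)) i

  bigAnd-any : ¬ X tt → (∀ {φ ψ} → X (φ ∧ ψ) → X φ ⊎ X ψ) →
    ∀ {m} (g : Fin m → Fml k d) → X (bigAnd g) → ∃[ i ] X (g i)
  bigAnd-any n h {zero} g x = ⊥-elim (n x)
  bigAnd-any n h {suc zero} g x = zero , x
  bigAnd-any n h {suc (suc m)} g x =
    Sum.[ zero ,_ , (λ y → Product.map suc id (bigAnd-any n h (g ∘ suc) y)) ]′ (h x)

  bigOr-any : ¬ X ff → (∀ {φ ψ} → X (φ ∨ ψ) → X φ ⊎ X ψ) →
    ∀ {m} (g : Fin m → Fml k d) → X (bigOr g) → ∃[ i ] X (g i)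
  bigOr-any n h {zero} g x = ⊥-elim (n x)
  bigOr-any n h {suc zero} g x = zero , x
  bigOr-any n h {suc (suc m)} g x =
    Sum.[ zero ,_ , (λ y → Product.map suc id (bigOr-any n h (g ∘ suc) y)) ]′ (h x)

-- Formulas from words

-- true stands for verification (tt, cHML) and false for refutation (ff, sHML).
leafF : ∀ {k d} → Bool → Fml k d
leafF true = tt
leafF false = ff

module _ {k : ℕ} where

  HasLeaf : Bool → ∀ {d} → Fml k d → Set
  HasLeaf b φ = Σ[ r ∈ Pos φ ] sub r ≡ leafF b

  LeafAt : Bool → {φ : Fml k 1} → Pos φ → Set
  LeafAt b r = sub r ≡ leafF b ⊎ (Σ[ i ∈ Fin (depth r) ] (sub r ≡ var i × resolve r i ≡ inj₁ zero))

  -- A compositional substitute for `CanRefute` and `CanVerify`, which refer to an enclosing closed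
  -- formula. The variable counts as an exit because its future binder contains a leaf.
  Leafy : Bool → Fml k 1 → Set
  Leafy b φ = (p : Pos φ) → Σ[ r ∈ Pos φ ] (p ≼ r × LeafAt b r)

  leafy-leaf : ∀ b → Leafy b (leafF b)
  leafy-leaf true here = here , ≼here , inj₁ refl
  leafy-leaf false here = here , ≼here , inj₁ refl

  leafy-var : ∀ {b} → Leafy b (var zero)
  leafy-var here = here , ≼here , inj₂ (zero , refl , refl)

  resolve-∧l : ∀ {φ ψ : Fml k 1} (r : Pos φ) {i} → resolve r i ≡ inj₁ zero → resolve (p∧l {ψ = ψ} r) i ≡ inj₁ zero
  resolve-∧l r f rewrite f = refl

  leafAt-∧l : ∀ {b} {φ ψ : Fml k 1} (r : Pos φ) → LeafAt b r → LeafAt b (p∧l {ψ = ψ} r)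
  leafAt-∧l r = Sum.map₂ λ { (i , e , f) → i , e , resolve-∧l r f }

  resolve-∧r : ∀ {φ ψ : Fml k 1} (r : Pos ψ) {i} → resolve r i ≡ inj₁ zero → resolve (p∧r {φ = φ} r) i ≡ inj₁ zero
  resolve-∧r r f rewrite f = refl

  leafAt-∧r : ∀ {b} {φ ψ : Fml k 1} (r : Pos ψ) → LeafAt b r → LeafAt b (p∧r {φ = φ} r)
  leafAt-∧r r = Sum.map₂ λ { (i , e , f) → i , e , resolve-∧r r f }

  resolve-∨l : ∀ {φ ψ : Fml k 1} (r : Pos φ) {i} → resolve r i ≡ inj₁ zero → resolve (p∨l {ψ = ψ} r) i ≡ inj₁ zero
  resolve-∨l r f rewrite f = refl

  leafAt-∨l : ∀ {b} {φ ψ : Fml k 1} (r : Pos φ) → LeafAt b r → LeafAt b (p∨l {ψ = ψ} r)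
  leafAt-∨l r = Sum.map₂ λ { (i , e , f) → i , e , resolve-∨l r f }

  resolve-∨r : ∀ {φ ψ : Fml k 1} (r : Pos ψ) {i} → resolve r i ≡ inj₁ zero → resolve (p∨r {φ = φ} r) i ≡ inj₁ zero
  resolve-∨r r f rewrite f = refl

  leafAt-∨r : ∀ {b} {φ ψ : Fml k 1} (r : Pos ψ) → LeafAt b r → LeafAt b (p∨r {φ = φ} r)
  leafAt-∨r r = Sum.map₂ λ { (i , e , f) → i , e , resolve-∨r r f }

  resolve-[] : ∀ {a} {φ : Fml k 1} (r : Pos φ) {i} → resolve r i ≡ inj₁ zero → resolve (p[] {a = a} r) i ≡ inj₁ zero
  resolve-[] r f rewrite f = refl

  leafAt-[] : ∀ {b} {a} {φ : Fml k 1} (r : Pos φ) → LeafAt b r → LeafAt b (p[] {a = a} r)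
  leafAt-[] r = Sum.map₂ λ { (i , e , f) → i , e , resolve-[] r f }

  resolve-⟨⟩ : ∀ {a} {φ : Fml k 1} (r : Pos φ) {i} → resolve r i ≡ inj₁ zero → resolve (p⟨⟩ {a = a} r) i ≡ inj₁ zero
  resolve-⟨⟩ r f rewrite f = refl

  leafAt-⟨⟩ : ∀ {b} {a} {φ : Fml k 1} (r : Pos φ) → LeafAt b r → LeafAt b (p⟨⟩ {a = a} r)
  leafAt-⟨⟩ r = Sum.map₂ λ { (i , e , f) → i , e , resolve-⟨⟩ r f }

  leafy-∧ : ∀ {b φ ψ} → Leafy b φ → Leafy b ψ → Leafy b (φ ∧ ψ)
  leafy-∧ l l' here = let r , _ , a = l here in p∧l r , ≼here , leafAt-∧l r a
  leafy-∧ l l' (p∧l p) = let r , q , a = l p in p∧l r , ≼∧l q , leafAt-∧l r a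
  leafy-∧ l l' (p∧r p) = let r , q , a = l' p in p∧r r , ≼∧r q , leafAt-∧r r a

  leafy-∨ : ∀ {b φ ψ} → Leafy b φ → Leafy b ψ → Leafy b (φ ∨ ψ)
  leafy-∨ l l' here = let r , _ , a = l here in p∨l r , ≼here , leafAt-∨l r a
  leafy-∨ l l' (p∨l p) = let r , q , a = l p in p∨l r , ≼∨l q , leafAt-∨l r a
  leafy-∨ l l' (p∨r p) = let r , q , a = l' p in p∨r r , ≼∨r q , leafAt-∨r r a

  leafy-[] : ∀ {b a φ} → Leafy b φ → Leafy b ([ a ] φ)
  leafy-[] l here = let r , _ , a = l here in p[] r , ≼here , leafAt-[] r a
  leafy-[] l (p[] p) = let r , q , a = l p in p[] r , ≼[] q , leafAt-[] r a

  leafy-⟨⟩ : ∀ {b a φ} → Leafy b φ → Leafy b (⟨ a ⟩ φ)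
  leafy-⟨⟩ l here = let r , _ , a = l here in p⟨⟩ r , ≼here , leafAt-⟨⟩ r a
  leafy-⟨⟩ l (p⟨⟩ p) = let r , q , a = l p in p⟨⟩ r , ≼⟨⟩ q , leafAt-⟨⟩ r a

  -- After a mismatch the search restarts behind the mismatching action, without a
  -- Knuth-Morris-Pratt fallback, so overlapping occurrences can be missed: for `aab`, the one in
  -- `aaab`. Thus `avoid` is implied by the absence of `w`, and `seek` implies its presence; these
  -- are the directions needed next to `φ` itself.
  avoid seek : List (Act k) → EHML k 1
  avoid [] = eff
  avoid (a ∷ w) = eBox λ b → if does (a Fin.≟ b) then avoid w else evar zero
  seek [] = ett
  seek (a ∷ w) = eDia λ b → if does (a Fin.≟ b) then seek w else evar zero

  if-case : ∀ {ℓ} (X : Fml k 1 → Set ℓ) {P : Set} (P? : Dec P) {e e' : EHML k 1} →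
            X ⌊ e ⌋ → X ⌊ e' ⌋ → X ⌊ if does P? then e else e' ⌋
  if-case X (isYes _) x y = x
  if-case X (isNo _) x y = y

  if-refl : ∀ {ℓ} (X : Fml k 1 → Set ℓ) (a : Act k) {e e' : EHML k 1} →
            X ⌊ e ⌋ → X ⌊ if does (a Fin.≟ a) then e else e' ⌋
  if-refl X a x with a Fin.≟ a
  ... | isYes _ = x
  ... | isNo n = ⊥-elim (n refl)

  avoid-all : (X : Fml k 1 → Set) → (∀ {φ ψ} → X φ → X ψ → X (φ ∧ ψ)) → (∀ {a φ} → X φ → X ([ a ] φ)) →
              X ff → X (var zero) → ∀ w → X ⌊ avoid w ⌋
  avoid-all X on∧ on[] onff onvar [] = onff
  avoid-all X on∧ on[] onff onvar (a ∷ w) = bigAnd-intro X on∧ _ a λ b →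
    on[] (if-case X (a Fin.≟ b) (avoid-all X on∧ on[] onff onvar w) onvar)

  seek-all : (X : Fml k 1 → Set) → (∀ {φ ψ} → X φ → X ψ → X (φ ∨ ψ)) → (∀ {a φ} → X φ → X (⟨ a ⟩ φ)) →
             X tt → X (var zero) → ∀ w → X ⌊ seek w ⌋
  seek-all X on∨ on⟨⟩ ontt onvar [] = ontt
  seek-all X on∨ on⟨⟩ ontt onvar (a ∷ w) = bigOr-intro X on∨ _ a λ b →
    on⟨⟩ (if-case X (a Fin.≟ b) (seek-all X on∨ on⟨⟩ ontt onvar w) onvar)

  avoid-guarded : ∀ w → ¬ Unguarded ⌊ avoid w ⌋ zero
  avoid-guarded [] ()
  avoid-guarded (a ∷ w) u
    with bigAnd-any (λ φ → Unguarded φ zero) (λ ()) (λ { (u∧l x) → inj₁ x ; (u∧r x) → inj₂ x })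
           (λ b → [ b ] ⌊ if does (a Fin.≟ b) then avoid w else evar zero ⌋) u
  ... | _ , ()

  seek-guarded : ∀ w → ¬ Unguarded ⌊ seek w ⌋ zero
  seek-guarded [] ()
  seek-guarded (a ∷ w) u
    with bigOr-any (λ φ → Unguarded φ zero) (λ ()) (λ { (u∨l x) → inj₁ x ; (u∨r x) → inj₂ x })
           (λ b → ⟨ b ⟩ ⌊ if does (a Fin.≟ b) then seek w else evar zero ⌋) u
  ... | _ , ()

  avoid-leaf : ∀ w → HasLeaf false ⌊ avoid w ⌋
  avoid-leaf [] = here , refl
  avoid-leaf (a ∷ w) = bigAnd-inject (HasLeaf false)
    (λ { (inj₁ (r , e)) → p∧l r , e ; (inj₂ (r , e)) → p∧r r , e }) _ a
    (Product.map p[] id (if-refl (HasLeaf false) a (avoid-leaf w)))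

  seek-leaf : ∀ w → HasLeaf true ⌊ seek w ⌋
  seek-leaf [] = here , refl
  seek-leaf (a ∷ w) = bigOr-inject (HasLeaf true)
    (λ { (inj₁ (r , e)) → p∨l r , e ; (inj₂ (r , e)) → p∨r r , e }) _ a
    (Product.map p⟨⟩ id (if-refl (HasLeaf true) a (seek-leaf w)))

  resolve-max : ∀ {φ : Fml k 1} (r : Pos φ) {i} → resolve r i ≡ inj₁ zero → resolve (pmax r) i ≡ inj₂ here
  resolve-max r f rewrite f = refl

  resolve-min : ∀ {φ : Fml k 1} (r : Pos φ) {i} → resolve r i ≡ inj₁ zero → resolve (pmin r) i ≡ inj₂ here
  resolve-min r f rewrite f = refl

  leafy-refutes : ∀ {φ : Fml k 1} → Leafy false φ → HasLeaf false φ → ∀ p → CanRefute (maxF φ) p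
  leafy-refutes l (r , e) here = 0 , r0 (pmax r , ≼here , e)
  leafy-refutes l (r , e) (pmax p) with l p
  ... | r' , q , inj₁ e' = 0 , r0 (pmax r' , ≼max q , e')
  ... | r' , q , inj₂ (i , e' , f) = 1 , rvar here (_ , refl) (≼here , λ ())
    (pmax r' , i , ≼max q , e' , resolve-max r' f) (r0 (pmax r , ≼here , e))

  leafy-verifies : ∀ {φ : Fml k 1} → Leafy true φ → HasLeaf true φ → ∀ p → CanVerify (minF φ) p
  leafy-verifies l (r , e) here = 0 , v0 (pmin r , ≼here , e)
  leafy-verifies l (r , e) (pmin p) with l p
  ... | r' , q , inj₁ e' = 0 , v0 (pmin r' , ≼min q , e')
  ... | r' , q , inj₂ (i , e' , f) = 1 , vvar here (_ , refl) (≼here , λ ())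
    (pmin r' , i , ≼min q , e' , resolve-min r' f) (v0 (pmin r , ≼here , e))

  -- An arrow t ⟶ b ∷ t', phrased through Dia to avoid equality of traces.
  Tail : Act k → Trace k → Trace k → Set₁
  Tail b t' t = ∀ {S : Trace k → Set} → S t' → Dia b S t

  box-intro : ∀ {ℓ b} {X : Trace k → Set ℓ} t → (∀ t' → Tail b t' t → X t') → Box b X t
  box-intro (fin []) h = _
  box-intro (fin (b ∷ l)) h refl = h _ (refl ,_)
  box-intro (inf g) h refl = h _ (refl ,_)

  dia-elim : ∀ {ℓ b} {X : Trace k → Set ℓ} t → Dia b X t → Σ[ t' ∈ Trace k ] (Tail b t' t × X t')
  dia-elim (fin (b ∷ l)) (refl , x) = _ , (refl ,_) , x
  dia-elim (inf g) (refl , x) = _ , (refl ,_) , x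

  module _ (w : List (Act k)) where

    Contains Lacks : Pred₀ k
    Contains t = ∃[ s ] Starts (s ++ w) t
    Lacks t = ¬ Contains t

    contains-tail : ∀ {b t t'} → Tail b t' t → Contains t' → Contains t
    contains-tail {b} tl (s , h) = b ∷ s , tl h

    avoid-holds : ∀ v {t ρ} → Lacks t → ¬ Starts v t → ⟦ ⌊ avoid v ⌋ ⟧ (extend Lacks ρ) t
    avoid-holds [] c n = ⊥-elim (n _)
    avoid-holds (a ∷ v) {t} {ρ} c n =
      bigAnd-intro (λ φ → ⟦ φ ⟧ (extend Lacks ρ) t) _,_ _ a λ b → box-intro t λ t' tl → rest b t' tl
      where
      rest : ∀ b t' → Tail b t' t → ⟦ ⌊ if does (a Fin.≟ b) then avoid v else evar zero ⌋ ⟧ (extend Lacks ρ) t'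
      rest b t' tl with a Fin.≟ b
      ... | isYes refl = avoid-holds v (c ∘ contains-tail tl) (n ∘ tl)
      ... | isNo _ = lift (c ∘ contains-tail tl)

    seek-holds : ∀ v {t ρ} → ⟦ ⌊ seek v ⌋ ⟧ (extend Contains ρ) t → Contains t ⊎ Starts v t
    seek-holds [] _ = inj₂ _
    seek-holds (a ∷ v) {t} {ρ} h
      with b , x ← bigOr-any (λ φ → ⟦ φ ⟧ (extend Contains ρ) t) Lift.lower id _ h
      with t' , tl , y ← dia-elim t x
      with a Fin.≟ b
    ... | isYes refl = Sum.map (contains-tail tl) tl (seek-holds v y)
    ... | isNo _ = inj₁ (contains-tail tl (Lift.lower y))

  word-SPIHML : ∀ (φ : Fml k 0) → Guarded φ → ∀ w → (∀ s t → Starts (s ++ w) t → ¬ ⟦ φ ⟧₀ t) →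
                Σ[ ψ ∈ Fml k 0 ] (Guarded ψ × SPIHML ψ × (⟦ ψ ⟧₀ ≐ ⟦ φ ⟧₀))
  word-SPIHML φ g w h = φ₁ ∧ φ ,
    g∧ (gmax (avoid-all Guarded g∧ g[] gff gvar w) (avoid-guarded w)) g ,
    (φ₁ , φ , refl , smax (avoid-all IsSHML s∧ s[] sff svar w) , (emax (avoid w) , refl) ,
      leafy-refutes (avoid-all (Leafy false) leafy-∧ leafy-[] (leafy-leaf false) leafy-var w) (avoid-leaf w)) ,
    -- The postfixed point is `Lacks w`: it is `Set`-valued, unlike `⟦ φ ⟧₀`, and includes it by
    -- `h`.
    λ t → proj₂ , λ x → (Lacks w , (λ t' c → avoid-holds w w c (λ st → c ([] , st))) , λ { (s , st) → h s t st x }) , x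
    where φ₁ = maxF ⌊ avoid w ⌋

  word-CPIHML : ∀ (φ : Fml k 0) → Guarded φ → ∀ w → (∀ s t → Starts (s ++ w) t → ⟦ φ ⟧₀ t) →
                Σ[ ψ ∈ Fml k 0 ] (Guarded ψ × CPIHML ψ × (⟦ ψ ⟧₀ ≐ ⟦ φ ⟧₀))
  word-CPIHML φ g w h = φ₁ ∨ φ ,
    g∨ (gmin (seek-all Guarded g∨ g⟨⟩ gtt gvar w) (seek-guarded w)) g ,
    (φ₁ , φ , refl , cmin (seek-all IsCHML c∨ c⟨⟩ ctt cvar w) , (emin (seek w) , refl) ,
      leafy-verifies (seek-all (Leafy true) leafy-∨ leafy-⟨⟩ (leafy-leaf true) leafy-var w) (seek-leaf w)) ,
    λ t → Sum.[ (λ x → let s , st = x (Contains w) (λ t' y → Sum.[ id , ([] ,_) ]′ (seek-holds w w y)) in h s t st)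
              , id ]′ , inj₂
    where φ₁ = minF ⌊ seek w ⌋

-- From explicit formulas to trees

module _ {k : ℕ} where

  -- The index is nothing for the leaf leafF b and just i for the free variable i.
  data Ends (b : Bool) : ∀ {d} → Fml k d → Maybe (Fin d) → Set where
    eleaf : ∀ {d} {φ : Fml k d} → φ ≡ leafF b → Ends b φ nothing
    eocc  : ∀ {d} {i : Fin d} → Ends b (var i) (just i)
    e∨l   : ∀ {d} {φ ψ : Fml k d} {x} → Ends b φ x → Ends b (φ ∨ ψ) x
    e∨r   : ∀ {d} {φ ψ : Fml k d} {x} → Ends b ψ x → Ends b (φ ∨ ψ) x
    e∧l   : ∀ {d} {φ ψ : Fml k d} {x} → Ends b φ x → Ends b (φ ∧ ψ) x
    e∧r   : ∀ {d} {φ ψ : Fml k d} {x} → Ends b ψ x → Ends b (φ ∧ ψ) x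
    e⟨⟩   : ∀ {d a} {φ : Fml k d} {x} → Ends b φ x → Ends b (⟨ a ⟩ φ) x
    e[]   : ∀ {d a} {φ : Fml k d} {x} → Ends b φ x → Ends b ([ a ] φ) x
    eminF : ∀ {d} {φ : Fml k (suc d)} {x} → Ends b φ (Maybe.map suc x) → Ends b (minF φ) x
    emaxF : ∀ {d} {φ : Fml k (suc d)} {x} → Ends b φ (Maybe.map suc x) → Ends b (maxF φ) x

  -- The number of unfoldings is forgotten: a variable bound strictly above a subformula is free in
  -- it, and having an exit at every subformula is all that `Live` asks for.
  AllEnd : Bool → ∀ {d} → Fml k d → Set
  AllEnd b φ = ∀ p → ∃[ x ] Ends b (sub {φ = φ} p) x

  module _ {b : Bool} where

    leaf-ends : ∀ {d} {φ : Fml k d} (r : Pos φ) → sub r ≡ leafF b → Ends b φ nothing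
    leaf-ends here e = eleaf e
    leaf-ends (p∨l r) e = e∨l (leaf-ends r e)
    leaf-ends (p∨r r) e = e∨r (leaf-ends r e)
    leaf-ends (p∧l r) e = e∧l (leaf-ends r e)
    leaf-ends (p∧r r) e = e∧r (leaf-ends r e)
    leaf-ends (p⟨⟩ r) e = e⟨⟩ (leaf-ends r e)
    leaf-ends (p[] r) e = e[] (leaf-ends r e)
    leaf-ends (pmin r) e = eminF (leaf-ends r e)
    leaf-ends (pmax r) e = emaxF (leaf-ends r e)

    leaf-below : ∀ {d} {φ : Fml k d} {p r : Pos φ} → p ≼ r → sub r ≡ leafF b → Ends b (sub p) nothing
    leaf-below {r = r} ≼here e = leaf-ends r e
    leaf-below (≼∨l q) e = leaf-below q e
    leaf-below (≼∨r q) e = leaf-below q e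
    leaf-below (≼∧l q) e = leaf-below q e
    leaf-below (≼∧r q) e = leaf-below q e
    leaf-below (≼⟨⟩ q) e = leaf-below q e
    leaf-below (≼[] q) e = leaf-below q e
    leaf-below (≼min q) e = leaf-below q e
    leaf-below (≼max q) e = leaf-below q e

    occ-ends : ∀ {d} {φ : Fml k d} (r : Pos φ) {i j} → sub r ≡ var i → resolve r i ≡ inj₁ j → Ends b φ (just j)
    occ-ends here refl refl = eocc
    occ-ends (p∨l r) {i} e f with resolve r i in g
    occ-ends (p∨l r) e refl | inj₁ j = e∨l (occ-ends r e g)
    occ-ends (p∨r r) {i} e f with resolve r i in g
    occ-ends (p∨r r) e refl | inj₁ j = e∨r (occ-ends r e g)
    occ-ends (p∧l r) {i} e f with resolve r i in g
    occ-ends (p∧l r) e refl | inj₁ j = e∧l (occ-ends r e g)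
    occ-ends (p∧r r) {i} e f with resolve r i in g
    occ-ends (p∧r r) e refl | inj₁ j = e∧r (occ-ends r e g)
    occ-ends (p⟨⟩ r) {i} e f with resolve r i in g
    occ-ends (p⟨⟩ r) e refl | inj₁ j = e⟨⟩ (occ-ends r e g)
    occ-ends (p[] r) {i} e f with resolve r i in g
    occ-ends (p[] r) e refl | inj₁ j = e[] (occ-ends r e g)
    occ-ends (pmin r) {i} e f with resolve r i in g
    occ-ends (pmin r) e refl | inj₁ (suc j) = eminF (occ-ends r e g)
    occ-ends (pmax r) {i} e f with resolve r i in g
    occ-ends (pmax r) e refl | inj₁ (suc j) = emaxF (occ-ends r e g)

    free-below : ∀ {d} {φ : Fml k d} {p r : Pos φ} {i j} → p ≼ r → sub r ≡ var i → resolve r i ≡ inj₁ j →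
                 ∃[ x ] Ends b (sub p) x
    free-below {r = r} ≼here e f = _ , occ-ends r e f
    free-below {r = p∨l r} {i} (≼∨l q) e f with resolve r i in g
    free-below (≼∨l q) e refl | inj₁ j = free-below q e g
    free-below {r = p∨r r} {i} (≼∨r q) e f with resolve r i in g
    free-below (≼∨r q) e refl | inj₁ j = free-below q e g
    free-below {r = p∧l r} {i} (≼∧l q) e f with resolve r i in g
    free-below (≼∧l q) e refl | inj₁ j = free-below q e g
    free-below {r = p∧r r} {i} (≼∧r q) e f with resolve r i in g
    free-below (≼∧r q) e refl | inj₁ j = free-below q e g
    free-below {r = p⟨⟩ r} {i} (≼⟨⟩ q) e f with resolve r i in g
    free-below (≼⟨⟩ q) e refl | inj₁ j = free-below q e g
    free-below {r = p[] r} {i} (≼[] q) e f with resolve r i in g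
    free-below (≼[] q) e refl | inj₁ j = free-below q e g
    free-below {r = pmin r} {i} (≼min q) e f with resolve r i in g
    free-below (≼min q) e refl | inj₁ (suc j) = free-below q e g
    free-below {r = pmax r} {i} (≼max q) e f with resolve r i in g
    free-below (≼max q) e refl | inj₁ (suc j) = free-below q e g

    -- On the way down to `p` the binder `q` is passed before `p` is reached; in that case,
    -- `inj₁ zero`, the occurrence is free in what remains and `free-below` takes over.
    bound-below : ∀ {d} {φ : Fml k d} {p r q : Pos φ} {i} → p ≼ r → sub r ≡ var i → resolve r i ≡ inj₂ q →
                  q ≺ p → ∃[ x ] Ends b (sub p) x
    bound-below ≼here e f (≼here , n) = ⊥-elim (n refl)
    bound-below {r = p∨l r} {i = i} (≼∨l s) e f (q , n) with resolve r i in g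
    bound-below (≼∨l s) e refl (≼∨l q , n) | inj₂ _ = bound-below s e g (q , n ∘ cong p∨l)
    bound-below {r = p∨r r} {i = i} (≼∨r s) e f (q , n) with resolve r i in g
    bound-below (≼∨r s) e refl (≼∨r q , n) | inj₂ _ = bound-below s e g (q , n ∘ cong p∨r)
    bound-below {r = p∧l r} {i = i} (≼∧l s) e f (q , n) with resolve r i in g
    bound-below (≼∧l s) e refl (≼∧l q , n) | inj₂ _ = bound-below s e g (q , n ∘ cong p∧l)
    bound-below {r = p∧r r} {i = i} (≼∧r s) e f (q , n) with resolve r i in g
    bound-below (≼∧r s) e refl (≼∧r q , n) | inj₂ _ = bound-below s e g (q , n ∘ cong p∧r)
    bound-below {r = p⟨⟩ r} {i = i} (≼⟨⟩ s) e f (q , n) with resolve r i in g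
    bound-below (≼⟨⟩ s) e refl (≼⟨⟩ q , n) | inj₂ _ = bound-below s e g (q , n ∘ cong p⟨⟩)
    bound-below {r = p[] r} {i = i} (≼[] s) e f (q , n) with resolve r i in g
    bound-below (≼[] s) e refl (≼[] q , n) | inj₂ _ = bound-below s e g (q , n ∘ cong p[])
    bound-below {r = pmin r} {i = i} (≼min s) e f (q , n) with resolve r i in g
    bound-below (≼min s) e refl _ | inj₁ zero = free-below s e g
    bound-below (≼min s) e refl (≼min q , n) | inj₂ _ = bound-below s e g (q , n ∘ cong pmin)
    bound-below {r = pmax r} {i = i} (≼max s) e f (q , n) with resolve r i in g
    bound-below (≼max s) e refl _ | inj₁ zero = free-below s e g
    bound-below (≼max s) e refl (≼max q , n) | inj₂ _ = bound-below s e g (q , n ∘ cong pmax)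

  refute-ends : ∀ {φ n p} → CanRefuteIn {k} φ n p → ∃[ x ] Ends false (sub p) x
  refute-ends (r0 (_ , s , e)) = _ , leaf-below s e
  refute-ends (rmon c) = refute-ends c
  refute-ends (rvar q _ q≺p (_ , _ , s , e , f) _) = bound-below s e f q≺p

  verify-ends : ∀ {φ n p} → CanVerifyIn {k} φ n p → ∃[ x ] Ends true (sub p) x
  verify-ends (v0 (_ , s , e)) = _ , leaf-below s e
  verify-ends (vmon c) = verify-ends c
  verify-ends (vvar q _ q≺p (_ , _ , s , e , f) _) = bound-below s e f q≺p

  data Repr : Bool → ∀ {d} → Fml k d → Tree k d → Set where
    Rff  : ∀ {d} → Repr false {d} ff leaf
    Rtt  : ∀ {d} → Repr true {d} tt leaf
    Rvar : ∀ {b d} {i : Fin d} → Repr b (var i) (var i)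
    R∧   : ∀ {d} {φ ψ : Fml k d} {T U} → Repr false φ T → Repr false ψ U → Repr false (φ ∧ ψ) (node T U)
    R∨   : ∀ {d} {φ ψ : Fml k d} {T U} → Repr true φ T → Repr true ψ U → Repr true (φ ∨ ψ) (node T U)
    Rmax : ∀ {d} {φ : Fml k (suc d)} {T} → Repr false φ T → Repr false (maxF φ) (fix T)
    Rmin : ∀ {d} {φ : Fml k (suc d)} {T} → Repr true φ T → Repr true (minF φ) (fix T)
    RBox : ∀ {d} {f : Act k → Fml k d} {g} → (∀ a → Repr false (f a) (g a)) →
           Repr false (bigAnd λ a → [ a ] f a) (box g)
    RDia : ∀ {d} {f : Act k → Fml k d} {g} → (∀ a → Repr true (f a) (g a)) →
           Repr true (bigOr λ a → ⟨ a ⟩ f a) (box g)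

  repr-hits : ∀ {b d} {φ : Fml k d} {T x} → Repr b φ T → Ends b φ x → ∃[ u ] Hit T u x
  repr-hits Rff (eleaf _) = _ , hleaf
  repr-hits Rtt (eleaf _) = _ , hleaf
  repr-hits Rvar eocc = _ , hvar
  repr-hits {b = false} Rvar (eleaf ())
  repr-hits {b = true} Rvar (eleaf ())
  repr-hits (R∧ R S) (e∧l e) = Product.map₂ hl (repr-hits R e)
  repr-hits (R∧ R S) (e∧r e) = Product.map₂ hr (repr-hits S e)
  repr-hits (R∨ R S) (e∨l e) = Product.map₂ hl (repr-hits R e)
  repr-hits (R∨ R S) (e∨r e) = Product.map₂ hr (repr-hits S e)
  repr-hits (Rmax R) (emaxF e) = Product.map₂ hfix (repr-hits R e)
  repr-hits (Rmin R) (eminF e) = Product.map₂ hfix (repr-hits R e)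
  repr-hits {x = x} (RBox {f = f} R) e
    with bigAnd-any (λ φ → Ends false φ x) (λ { (eleaf ()) }) (λ { (e∧l e) → inj₁ e ; (e∧r e) → inj₂ e }) (λ a → [ a ] f a) e
  ... | a , e[] e' = Product.map (a ∷_) hbox (repr-hits (R a) e')
  repr-hits {x = x} (RDia {f = f} R) e
    with bigOr-any (λ φ → Ends true φ x) (λ { (eleaf ()) }) (λ { (e∨l e) → inj₁ e ; (e∨r e) → inj₂ e }) (λ a → ⟨ a ⟩ f a) e
  ... | a , e⟨⟩ e' = Product.map (a ∷_) hbox (repr-hits (R a) e')

  repr-ung : ∀ {b d} {φ : Fml k d} {T i} → Repr b φ T → Ung T i → Unguarded φ i
  repr-ung Rvar refl = uvar
  repr-ung (R∧ R S) (inj₁ u) = u∧l (repr-ung R u)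
  repr-ung (R∧ R S) (inj₂ u) = u∧r (repr-ung S u)
  repr-ung (R∨ R S) (inj₁ u) = u∨l (repr-ung R u)
  repr-ung (R∨ R S) (inj₂ u) = u∨r (repr-ung S u)
  repr-ung (Rmax R) u = umax (repr-ung R u)
  repr-ung (Rmin R) u = umin (repr-ung R u)

  onNext-dia : ∀ {V : Act k → Trace k → Set₁} t → OnNext V t → ∃[ a ] Dia a (V a) t
  onNext-dia (fin (a ∷ l)) v = a , refl , v
  onNext-dia (inf g) v = g zero , refl , v

  dia-map : ∀ {a} {X Y : Trace k → Set₁} → (∀ t → X t → Y t) → ∀ t → Dia a X t → Dia a Y t
  dia-map h (fin (b ∷ l)) (e , x) = e , h _ x
  dia-map h (inf g) (e , x) = e , h _ x

  box-dia : ∀ {a} {X Y : Trace k → Set₁} → (∀ t → X t → Y t → ⊥) → ∀ t → Box a X t → Dia a Y t → ⊥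
  box-dia h (fin (b ∷ l)) x (e , y) = h _ (x e) y
  box-dia h (inf g) x (e , y) = h _ (x e) y

  ver-sound : ∀ {d} {φ : Fml k d} {T ρ} → Repr true φ T → ∀ t → Ver T ρ t → ⟦ φ ⟧ ρ t
  ver-sound Rtt t v = _
  ver-sound Rvar t v = v
  ver-sound (R∨ R S) t = Sum.map (ver-sound R t) (ver-sound S t)
  ver-sound (Rmin R) t v P pre = v P λ t' x → pre t' (ver-sound R t' x)
  ver-sound {ρ = ρ} (RDia {f = f} R) t v =
    let a , x = onNext-dia t v
    in bigOr-inject (λ φ → ⟦ φ ⟧ ρ t) id (λ a → ⟨ a ⟩ f a) a (dia-map (ver-sound (R a)) t x)

  Disjoint : ∀ {d} → Env k d → Env k d → Set
  Disjoint ρ ρ' = ∀ i t → ρ i t → ρ' i t → ⊥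

  ver-refutes : ∀ {d} {φ : Fml k d} {T ρ ρ'} → Repr false φ T → Disjoint ρ ρ' → ∀ t → ⟦ φ ⟧ ρ t → Ver T ρ' t → ⊥
  ver-refutes Rff D t (lift ()) v
  ver-refutes Rvar D t (lift x) (lift y) = D _ t x y
  ver-refutes (R∧ R S) D t (x , y) (inj₁ v) = ver-refutes R D t x v
  ver-refutes (R∧ R S) D t (x , y) (inj₂ v) = ver-refutes S D t y v
  ver-refutes (Rmax R) D t (P , post , x) v =
    -- The complement of a postfixed point of the formula is a prefixed point of the refutation
    -- condition.
    v (¬_ ∘ P) (λ t' y z → ver-refutes R (λ { zero t p n → n p ; (suc i) → D i }) t' (post t' z) y) x
  ver-refutes {ρ = ρ} (RBox {f = f} R) D t x v =
    let a , y = onNext-dia t v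
    in box-dia (ver-refutes (R a) D) t (bigAnd-all (λ φ → ⟦ φ ⟧ ρ t) id (λ a → [ a ] f a) x a) y

  Represented : Bool → ∀ {d} → Fml k d → Set
  Represented b {d} φ = Σ[ T ∈ Tree k d ] (Repr b φ T × Live T)

  represented-hits : ∀ {b d} {φ : Fml k d} {T} → Repr b φ T → AllEnd b φ → Hits T
  represented-hits R ends = let x , e = ends here ; u , h = repr-hits R e in u , x , h

  represented-fix : ∀ {b d} {φ : Fml k d} {ψ : Fml k (suc d)} →
                    (∀ {T} → Repr b ψ T → Repr b φ (fix T)) → AllEnd b φ → ¬ Unguarded ψ zero →
                    Represented b ψ → Represented b φ
  represented-fix R ends ¬u (T , S , l) =
    fix T , R S , represented-hits (R S) ends , (λ u → ¬u (repr-ung S u)) , l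

  -- A disjunction over all actions belongs to sHML only when there are no actions, and then it is
  -- the leaf `ff`.
  bigOr-sHML : ∀ {d m} {h : Fin m → Act k} (g : Fin m → Fml k d) → IsSHML (bigOr λ i → ⟨ h i ⟩ g i) →
               bigOr (λ i → ⟨ h i ⟩ g i) ≡ ff
  bigOr-sHML {m = zero} g _ = refl
  bigOr-sHML {m = suc zero} g ()
  bigOr-sHML {m = suc (suc m)} g ()

  bigAnd-cHML : ∀ {d m} {h : Fin m → Act k} (g : Fin m → Fml k d) → IsCHML (bigAnd λ i → [ h i ] g i) →
                bigAnd (λ i → [ h i ] g i) ≡ tt
  bigAnd-cHML {m = zero} g _ = refl
  bigAnd-cHML {m = suc zero} g ()
  bigAnd-cHML {m = suc (suc m)} g ()

  sHML-tree : ∀ {d} (e : EHML k d) → IsSHML ⌊ e ⌋ → Guarded ⌊ e ⌋ → AllEnd false ⌊ e ⌋ → Represented false ⌊ e ⌋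
  sHML-tree ett s g ends with ends here
  ... | _ , eleaf ()
  sHML-tree eff s g ends = leaf , Rff , _
  sHML-tree (emax e) (smax s) (gmax g ¬u) ends = represented-fix Rmax ends ¬u (sHML-tree e s g (ends ∘ pmax))
  sHML-tree (evar i) s g ends = var i , Rvar , _
  sHML-tree (e e∧ e') (s∧ s s') (g∧ g g') ends =
    let T , R , l = sHML-tree e s g (ends ∘ p∧l)
        T' , R' , l' = sHML-tree e' s' g' (ends ∘ p∧r)
    in node T T' , R∧ R R' , l , l'
  sHML-tree (eDia f) s g ends =
    leaf , ≡.subst (λ φ → Repr false φ leaf) (sym (bigOr-sHML (λ a → ⌊ f a ⌋) s)) Rff , _
  sHML-tree (eBox f) s g ends = box (proj₁ ∘ child) , R , represented-hits R ends , (λ a → proj₂ (proj₂ (child a)))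
    where
    boxes : Act k → Fml k _
    boxes a = [ a ] ⌊ f a ⌋
    un-s : ∀ {a φ} → IsSHML ([ a ] φ) → IsSHML φ
    un-s (s[] s) = s
    un-g : ∀ {a} {φ : Fml k _} → Guarded ([ a ] φ) → Guarded φ
    un-g (g[] g) = g
    child : ∀ a → Represented false ⌊ f a ⌋
    child a = sHML-tree (f a)
      (un-s (bigAnd-all IsSHML (λ { (s∧ s s') → s , s' }) boxes s a))
      (un-g (bigAnd-all Guarded (λ { (g∧ g g') → g , g' }) boxes g a))
      (bigAnd-all (AllEnd false) (λ h → h ∘ p∧l , h ∘ p∧r) boxes ends a ∘ p[])
    R = RBox λ a → proj₁ (proj₂ (child a))

  cHML-tree : ∀ {d} (e : EHML k d) → IsCHML ⌊ e ⌋ → Guarded ⌊ e ⌋ → AllEnd true ⌊ e ⌋ → Represented true ⌊ e ⌋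
  cHML-tree eff s g ends with ends here
  ... | _ , eleaf ()
  cHML-tree ett s g ends = leaf , Rtt , _
  cHML-tree (emin e) (cmin s) (gmin g ¬u) ends = represented-fix Rmin ends ¬u (cHML-tree e s g (ends ∘ pmin))
  cHML-tree (evar i) s g ends = var i , Rvar , _
  cHML-tree (e e∨ e') (c∨ s s') (g∨ g g') ends =
    let T , R , l = cHML-tree e s g (ends ∘ p∨l)
        T' , R' , l' = cHML-tree e' s' g' (ends ∘ p∨r)
    in node T T' , R∨ R R' , l , l'
  cHML-tree (eBox f) s g ends =
    leaf , ≡.subst (λ φ → Repr true φ leaf) (sym (bigAnd-cHML (λ a → ⌊ f a ⌋) s)) Rtt , _
  cHML-tree (eDia f) s g ends = box (proj₁ ∘ child) , R , represented-hits R ends , (λ a → proj₂ (proj₂ (child a)))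
    where
    diamonds : Act k → Fml k _
    diamonds a = ⟨ a ⟩ ⌊ f a ⌋
    un-c : ∀ {a φ} → IsCHML (⟨ a ⟩ φ) → IsCHML φ
    un-c (c⟨⟩ s) = s
    un-g : ∀ {a} {φ : Fml k _} → Guarded (⟨ a ⟩ φ) → Guarded φ
    un-g (g⟨⟩ g) = g
    child : ∀ a → Represented true ⌊ f a ⌋
    child a = cHML-tree (f a)
      (un-c (bigOr-all IsCHML (λ { (c∨ s s') → s , s' }) diamonds s a))
      (un-g (bigOr-all Guarded (λ { (g∨ g g') → g , g' }) diamonds g a))
      (bigOr-all (AllEnd true) (λ h → h ∘ p∨l , h ∘ p∨r) diamonds ends a ∘ p⟨⟩)
    R = RDia λ a → proj₁ (proj₂ (child a))

  SPIHML-word : ∀ {ψ : Fml k 0} → Guarded ψ → SPIHML ψ → ∃[ w ] (∀ s t → Starts (s ++ w) t → ¬ ⟦ ψ ⟧₀ t)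
  SPIHML-word (g∧ g _) (_ , _ , refl , s , (e , refl) , refutes) =
    let T , R , l = sHML-tree e s g (λ p → refute-ends (proj₂ (refutes p)))
        w , h = tree-word T l
    in w , λ s t st x → ver-refutes R (λ ()) t (proj₁ x) (h s t st)

  CPIHML-word : ∀ {ψ : Fml k 0} → Guarded ψ → CPIHML ψ → ∃[ w ] (∀ s t → Starts (s ++ w) t → ⟦ ψ ⟧₀ t)
  CPIHML-word (g∨ g _) (_ , _ , refl , s , (e , refl) , verifies) =
    let T , R , l = cHML-tree e s g (λ p → verify-ends (proj₂ (verifies p)))
        w , h = tree-word T l
    in w , λ s t st → inj₁ (ver-sound R t (h s t st))

-- The two equivalences

module _ {k : ℕ} where

  rej-concludes : ∀ {m : Mon k 0} t → rej m t ⇔ Concludes no m t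
  rej-concludes (fin l) = ⇔-id _
  rej-concludes (inf g) = ⇔-id _

  acc-concludes : ∀ {m : Mon k 0} t → acc m t ⇔ Concludes yes m t
  acc-concludes (fin l) = ⇔-id _
  acc-concludes (inf g) = ⇔-id _

  violation⇔SPIHML : ∀ (φ : Fml k 0) → Guarded φ →
    (Σ (Mon k 0) λ m → Sound m ⟦ φ ⟧₀ × ViolationPI m)
      ⇔ (Σ (Fml k 0) λ ψ → Guarded ψ × SPIHML ψ × (⟦ ψ ⟧₀ ≐ ⟦ φ ⟧₀))
  violation⇔SPIHML φ g = mk⇔
    (λ { (m , sound , pi) →
      let w , h = monitor-word m ⊗ (λ s → Product.map₂ (λ {f} → to (rej-concludes (s · f))) (pi s))
      in word-SPIHML φ g w λ s t st → proj₂ (sound t) (from (rej-concludes t) (h s t st)) })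
    (λ { (ψ , gψ , sp , eq) →
      let w , h = SPIHML-word gψ sp
      in seeker no w ,
         (λ t → (λ a → case seeker-concludes w t (to (acc-concludes t) a) of λ { (inj₁ ()) ; (inj₂ (() , _)) })
              , (λ r x → case seeker-concludes w t (to (rej-concludes t) r) of λ
                  { (inj₁ ()) ; (inj₂ (_ , s , st)) → h s t st (proj₂ (eq t) x) })) ,
         λ s → fin w , from (rej-concludes (s · fin w)) (seeker-pi no w s) })

  satisfaction⇔CPIHML : ∀ (φ : Fml k 0) → Guarded φ →
    (Σ (Mon k 0) λ m → Sound m ⟦ φ ⟧₀ × SatisfactionPI m)
      ⇔ (Σ (Fml k 0) λ ψ → Guarded ψ × CPIHML ψ × (⟦ ψ ⟧₀ ≐ ⟦ φ ⟧₀))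
  satisfaction⇔CPIHML φ g = mk⇔
    (λ { (m , sound , pi) →
      let w , h = monitor-word m ⊕ (λ s → Product.map₂ (λ {f} → to (acc-concludes (s · f))) (pi s))
      in word-CPIHML φ g w λ s t st → proj₁ (sound t) (from (acc-concludes t) (h s t st)) })
    (λ { (ψ , gψ , cp , eq) →
      let w , h = CPIHML-word gψ cp
      in seeker yes w ,
         (λ t → (λ a → case seeker-concludes w t (to (acc-concludes t) a) of λ
                  { (inj₁ ()) ; (inj₂ (_ , s , st)) → proj₁ (eq t) (h s t st) })
              , (λ r → case seeker-concludes w t (to (rej-concludes t) r) of λ { (inj₁ ()) ; (inj₂ (() , _)) })) ,
         λ s → fin w , from (acc-concludes (s · fin w)) (seeker-pi yes w s) })

theorem5 : ∀ (k : ℕ) (φ : Fml k 0) → Guarded φ →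
    ((Σ (Mon k 0) λ m → Sound m ⟦ φ ⟧₀ × ViolationPI m)
    ⇔ (Σ (Fml k 0) λ ψ → Guarded ψ × SPIHML ψ × (⟦ ψ ⟧₀ ≐ ⟦ φ ⟧₀)))
    × ((Σ (Mon k 0) λ m → Sound m ⟦ φ ⟧₀ × SatisfactionPI m)
    ⇔ (Σ (Fml k 0) λ ψ → Guarded ψ × CPIHML ψ × (⟦ ψ ⟧₀ ≐ ⟦ φ ⟧₀)))
theorem5 k φ g = violation⇔SPIHML φ g , satisfaction⇔CPIHML φ g
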